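{- If $\tau=1010$ or $\tau=1120$, then $$f_\tau(x)=\frac{(1-x)(1-5x+7x^2-x^3)}{(1-2x)^2(1-3x+x^2)}$$ as formal power series in $x$, where $f_\tau(x)=\sum_{n\ge 0} b_n(\tau)x^n$ and $b_n(\tau)$ is the number of ascent sequences of length $n$ that avoid both patterns $021$ and $\tau$.
   Context: For a finite sequence $w=w_1\cdots w_n$ of integers, $\mathrm{asc}(w)$ is the number of indices $1\le i\le n-1$ with $w_i<w_{i+1}$. An ascent sequence of length $n\ge 1$ is a sequence $a_1\cdots a_n$ of non-negative integers such that $a_1=0$ and $a_i\le \mathrm{asc}(a_1\cdots a_{i-1})+1$ for $1<i\le n$; there is exactly one (empty) ascent sequence of length $0$. A sequence $\pi=\pi_1\cdots\pi_n$ contains a pattern $\tau=\tau_1\cdots\tau_m$ if there are indices $1\le i_1<\cdots<i_m\le n$ such that for all $j,k\in\{1,\dots,m\}$: $\pi_{i_j}<\pi_{i_k}$ iff $\tau_j<\tau_k$, and $\pi_{i_j}=\pi_{i_k}$ iff $\tau_j=\tau_k$; otherwise $\pi$ avoids $\tau$. For a pattern $\tau$, $B_n(\tau)$ is the set of ascent sequences of length $n$ avoiding both $021$ and $\tau$ (with $B_0(\tau)$ consisting of the empty sequence), and $b_n(\tau)=|B_n(\tau)|$. -}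

module Defs where

open import Data.Bool.Base using (true; false; if_then_else_)
open import Data.Nat.Base as ℕ using (ℕ; zero; suc; _≤_; _<_; z≤n; s≤s)
import Data.Nat.Properties as ℕ
open import Data.Integer.Base as ℤ using (ℤ; +_; -_; 0ℤ; 1ℤ)
import Data.Integer.Properties as ℤ
open import Data.Fin.Base as Fin using (Fin; zero; suc; toℕ)
import Data.Fin.Properties as Fin
open import Data.List.Base as List
  using (List; []; _∷_; length; lookup; take; filter; upTo; cartesianProductWith)
import Data.List.Properties as List
open import Data.List.Membership.Propositional using (_∈_)
open import Data.List.Membership.Propositional.Properties
  using (∈-upTo⁺; ∈-filter⁺; ∈-filter⁻
        ; ∈-cartesianProductWith⁺; ∈-cartesianProductWith⁻)
open import Data.List.Relation.Unary.Any using (here)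
import Data.List.Relation.Unary.All as All
import Data.List.Relation.Unary.AllPairs as AllPairs
open import Data.List.Relation.Unary.Unique.Propositional using (Unique)
import Data.List.Relation.Unary.Unique.Propositional.Properties as Unique
open import Data.Vec.Base as Vec using (Vec; []; _∷_)
open import Data.Product.Base using (∃; ∃-syntax; _×_; _,_; proj₁; proj₂)
open import Function.Base using (_∘_)
open import Function.Bundles using (_⇔_; mk⇔; Equivalence)
open import Relation.Nullary using (¬_; Dec; does; yes; no)
open import Relation.Nullary.Decidable using (map′; ¬?; _×-dec_; _→-dec_)
open import Relation.Unary using (Pred; Decidable)
open import Relation.Binary.PropositionalEquality
  using (_≡_; refl; cong; cong₂; module ≡-Reasoning)
open import Algebra.Properties.Semiring.Sum ℤ.+-*-semiring using (sum-syntax)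

asc : List ℕ → ℕ
asc []          = 0
asc (_ ∷ [])    = 0
asc (x ∷ y ∷ w) = (if does (x ℕ.<? y) then 1 else 0) ℕ.+ asc (y ∷ w)

-- Positions are counted from 0, so the prefix strictly before position i
-- is `take (toℕ i) a`.
IsAscentSequence : List ℕ → Set
IsAscentSequence a =
    (∀ i → toℕ i ≡ 0 → lookup a i ≡ 0)
  × (∀ i → 0 < toℕ i → lookup a i ≤ asc (take (toℕ i) a) ℕ.+ 1)

IsOccurrence : (π τ : List ℕ) → Vec (Fin (length π)) (length τ) → Set
IsOccurrence π τ ι =
    (∀ j k → j Fin.< k → Vec.lookup ι j Fin.< Vec.lookup ι k)
  × (∀ j k →
        (lookup π (Vec.lookup ι j) < lookup π (Vec.lookup ι k) ⇔ lookup τ j < lookup τ k)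
      × (lookup π (Vec.lookup ι j) ≡ lookup π (Vec.lookup ι k) ⇔ lookup τ j ≡ lookup τ k))

_Contains_ : (π τ : List ℕ) → Set
π Contains τ = ∃[ ι ] IsOccurrence π τ ι

_Avoids_ : (π τ : List ℕ) → Set
π Avoids τ = ¬ (π Contains τ)

p021 p1010 p1120 : List ℕ
p021  = 0 ∷ 2 ∷ 1 ∷ []
p1010 = 1 ∷ 0 ∷ 1 ∷ 0 ∷ []
p1120 = 1 ∷ 1 ∷ 2 ∷ 0 ∷ []

B : (τ : List ℕ) (n : ℕ) → Pred (List ℕ) _
B τ n w = length w ≡ n × IsAscentSequence w × w Avoids p021 × w Avoids τ

_⇔-dec_ : ∀ {p q} {P : Set p} {Q : Set q} → Dec P → Dec Q → Dec (P ⇔ Q)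
P? ⇔-dec Q? =
  map′ (λ (f , g) → mk⇔ f g) (λ e → Equivalence.to e , Equivalence.from e)
       ((P? →-dec Q?) ×-dec (Q? →-dec P?))

anyVec? : ∀ {k} m {p} {P : Pred (Vec (Fin k) m) p} → Decidable P → Dec (∃ P)
anyVec? zero    P? = map′ ([] ,_) (λ { ([] , p) → p }) (P? [])
anyVec? (suc m) P? =
  map′ (λ (x , v , p) → x ∷ v , p) (λ { (x ∷ v , p) → x , v , p })
       (Fin.any? λ x → anyVec? m λ v → P? (x ∷ v))

isAscentSequence? : Decidable IsAscentSequence
isAscentSequence? a =
        Fin.all? (λ i → (toℕ i ℕ.≟ 0) →-dec (lookup a i ℕ.≟ 0))
  ×-dec Fin.all? (λ i → (0 ℕ.<? toℕ i) →-dec (lookup a i ℕ.≤? asc (take (toℕ i) a) ℕ.+ 1))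

isOccurrence? : ∀ π τ → Decidable (IsOccurrence π τ)
isOccurrence? π τ ι =
        Fin.all? (λ j → Fin.all? λ k →
          (j Fin.<? k) →-dec (Vec.lookup ι j Fin.<? Vec.lookup ι k))
  ×-dec Fin.all? (λ j → Fin.all? λ k →
          ((lookup π (Vec.lookup ι j) ℕ.<? lookup π (Vec.lookup ι k))
             ⇔-dec (lookup τ j ℕ.<? lookup τ k))
          ×-dec
          ((lookup π (Vec.lookup ι j) ℕ.≟ lookup π (Vec.lookup ι k))
             ⇔-dec (lookup τ j ℕ.≟ lookup τ k)))

_contains?_ : ∀ π τ → Dec (π Contains τ)
π contains? τ = anyVec? (length τ) (isOccurrence? π τ)

B? : ∀ τ n → Decidable (B τ n)
B? τ n w =
  (length w ℕ.≟ n) ×-dec isAscentSequence? w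
  ×-dec ¬? (w contains? p021) ×-dec ¬? (w contains? τ)

words : (k n : ℕ) → List (List ℕ)
words k zero    = [] ∷ []
words k (suc n) = cartesianProductWith _∷_ (upTo k) (words k n)

-- An ascent sequence of length n has all its entries at most n, so filtering
-- the words of length n over {0,…,n} yields all of B τ n; see `B-list-correct`.
B-list : (τ : List ℕ) (n : ℕ) → List (List ℕ)
B-list τ n = filter (B? τ n) (words (suc n) n)

b : (τ : List ℕ) (n : ℕ) → ℕ
b τ n = length (B-list τ n)

words-unique : ∀ k n → Unique (words k n)
words-unique k zero    = All.[] AllPairs.∷ AllPairs.[]
words-unique k (suc n) =
  Unique.cartesianProductWith⁺ _∷_ List.∷-injective (Unique.upTo⁺ k) (words-unique k n)

∈-words : ∀ k w → (∀ i → lookup w i < k) → w ∈ words k (length w)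
∈-words k []      _ = here refl
∈-words k (x ∷ w) h =
  ∈-cartesianProductWith⁺ _∷_ (∈-upTo⁺ (h zero)) (∈-words k w (h ∘ suc))

asc≤length : ∀ w → asc w ≤ length w
asc≤length []          = z≤n
asc≤length (_ ∷ [])    = z≤n
asc≤length (x ∷ y ∷ w) =
  ℕ.+-mono-≤ (bit≤1 (does (x ℕ.<? y))) (asc≤length (y ∷ w))
  where
  bit≤1 : ∀ c → (if c then 1 else 0) ≤ 1
  bit≤1 true  = s≤s z≤n
  bit≤1 false = z≤n

ascent-entry≤length : ∀ {a} → IsAscentSequence a → ∀ i → lookup a i ≤ length a
ascent-entry≤length {a} (first , rest) i with toℕ i ℕ.≟ 0
... | yes i≡0 = ℕ.≤-trans (ℕ.≤-reflexive (first i i≡0)) z≤n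
... | no  i≢0 = begin
  lookup a i                       ≤⟨ rest i (ℕ.n≢0⇒n>0 i≢0) ⟩
  asc (take (toℕ i) a) ℕ.+ 1       ≤⟨ ℕ.+-monoˡ-≤ 1 (asc≤length (take (toℕ i) a)) ⟩
  length (take (toℕ i) a) ℕ.+ 1    ≡⟨ cong (ℕ._+ 1) (List.length-take (toℕ i) a) ⟩
  toℕ i ℕ.⊓ length a ℕ.+ 1         ≤⟨ ℕ.+-monoˡ-≤ 1 (ℕ.m⊓n≤m (toℕ i) (length a)) ⟩
  toℕ i ℕ.+ 1                      ≡⟨ ℕ.+-comm (toℕ i) 1 ⟩
  suc (toℕ i)                      ≤⟨ Fin.toℕ<n i ⟩
  length a                         ∎
  where open ℕ.≤-Reasoning

B-list-unique : ∀ τ n → Unique (B-list τ n)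
B-list-unique τ n = Unique.filter⁺ (B? τ n) (words-unique (suc n) n)

B-list-correct : ∀ τ n w → w ∈ B-list τ n ⇔ B τ n w
B-list-correct τ n w = mk⇔ (proj₂ ∘ ∈-filter⁻ (B? τ n) {xs = words (suc n) n}) complete
  where
  complete : B τ n w → w ∈ B-list τ n
  complete p@(refl , ascent , _) =
    ∈-filter⁺ (B? τ n) (∈-words (suc n) w (s≤s ∘ ascent-entry≤length ascent)) p

Series : Set
Series = ℕ → ℤ

infix  4 _≈_
infixl 7 _*_ _÷_[_]

_≈_ : Series → Series → Set
f ≈ g = ∀ n → f n ≡ g n

_*_ : Series → Series → Series
(f * g) n = ∑[ i < suc n ] (f (toℕ i) ℤ.* g (n ℕ.∸ toℕ i))

-- The polynomial with the given coefficients, constant term first.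
poly : List ℤ → Series
poly []       _       = 0ℤ
poly (c ∷ _)  zero    = c
poly (_ ∷ cs) (suc n) = poly cs n

remainder : (f g : Series) → Series
remainder f g n = f (suc n) ℤ.- f 0 ℤ.* g (suc n)

-- Long division by a series with constant term 1: with g = 1 + x g′ and
-- f = f₀ + x f′, the quotient is f₀ + x ((f′ - f₀ g′) ÷ g).  `÷-*-cancel` and `÷-unique` show that
-- it is the unique series q with q g = f.
_÷_[_] : (f g : Series) → g 0 ≡ 1ℤ → Series
(f ÷ g [ e ]) zero    = f 0
(f ÷ g [ e ]) (suc n) = (remainder f g ÷ g [ e ]) n

÷-*-cancel : ∀ f g (e : g 0 ≡ 1ℤ) → (f ÷ g [ e ]) * g ≈ f
÷-*-cancel f g e zero = begin
  f 0 ℤ.* g 0 ℤ.+ 0ℤ  ≡⟨ ℤ.+-identityʳ _ ⟩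
  f 0 ℤ.* g 0         ≡⟨ cong (f 0 ℤ.*_) e ⟩
  f 0 ℤ.* 1ℤ          ≡⟨ ℤ.*-identityʳ _ ⟩
  f 0                 ∎
  where open ≡-Reasoning
÷-*-cancel f g e (suc n) = begin
  c ℤ.+ ((remainder f g ÷ g [ e ]) * g) n
    ≡⟨ cong (λ z → c ℤ.+ z) (÷-*-cancel (remainder f g) g e n) ⟩
  c ℤ.+ (f (suc n) ℤ.- c)      ≡⟨ ℤ.+-comm c _ ⟩
  f (suc n) ℤ.- c ℤ.+ c        ≡⟨ ℤ.+-assoc (f (suc n)) (- c) c ⟩
  f (suc n) ℤ.+ (- c ℤ.+ c)    ≡⟨ cong (λ z → f (suc n) ℤ.+ z) (ℤ.+-inverseˡ c) ⟩
  f (suc n) ℤ.+ 0ℤ             ≡⟨ ℤ.+-identityʳ _ ⟩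
  f (suc n)                    ∎
  where
  open ≡-Reasoning
  c : ℤ
  c = f 0 ℤ.* g (suc n)

÷-unique : ∀ q f g (e : g 0 ≡ 1ℤ) → q * g ≈ f → q ≈ f ÷ g [ e ]
÷-unique q f g e h = go
  where
  open ≡-Reasoning
  q₀≡f₀ : q 0 ≡ f 0
  q₀≡f₀ = begin
    q 0                 ≡⟨ ℤ.*-identityʳ _ ⟨
    q 0 ℤ.* 1ℤ          ≡⟨ cong (q 0 ℤ.*_) e ⟨
    q 0 ℤ.* g 0         ≡⟨ ℤ.+-identityʳ _ ⟨
    q 0 ℤ.* g 0 ℤ.+ 0ℤ  ≡⟨ h 0 ⟩
    f 0                 ∎
  tail-eq : (q ∘ suc) * g ≈ remainder f g
  tail-eq n = begin
    t                        ≡⟨ ℤ.+-identityʳ t ⟨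
    t ℤ.+ 0ℤ                 ≡⟨ cong (λ z → t ℤ.+ z) (ℤ.+-inverseʳ c) ⟨
    t ℤ.+ (c ℤ.- c)          ≡⟨ ℤ.+-assoc t c (- c) ⟨
    t ℤ.+ c ℤ.- c            ≡⟨ cong (ℤ._- c) (ℤ.+-comm t c) ⟩
    c ℤ.+ t ℤ.- c            ≡⟨ cong₂ (λ y z → y ℤ.- z ℤ.* g (suc n)) (h (suc n)) q₀≡f₀ ⟩
    f (suc n) ℤ.- f 0 ℤ.* g (suc n) ∎
    where
    c t : ℤ
    c = q 0 ℤ.* g (suc n)
    t = ((q ∘ suc) * g) n
  go : q ≈ f ÷ g [ e ]
  go zero    = q₀≡f₀
  go (suc n) = ÷-unique (q ∘ suc) (remainder f g) g e tail-eq n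

genFun : List ℕ → Series
genFun τ n = + b τ n

-- (1 - x)(1 - 5x + 7x² - x³)
numerator : Series
numerator =
  poly (1ℤ ∷ - 1ℤ ∷ []) * poly (1ℤ ∷ - + 5 ∷ + 7 ∷ - 1ℤ ∷ [])

-- (1 - 2x)²(1 - 3x + x²)
denominator : Series
denominator =
    poly (1ℤ ∷ - + 2 ∷ []) * poly (1ℤ ∷ - + 2 ∷ [])
  * poly (1ℤ ∷ - + 3 ∷ 1ℤ ∷ [])

{-# OPTIONS --safe #-}
module Submission where

-- An ascent sequence avoids 021 iff its nonzero letters weakly increase.  So after a prefix
-- with largest letter m and m + d ascents the next letter is 0, m, or one of
-- m + 1, …, m + 1 + d.  The second pattern says that no 0 may follow a trigger: x0x for 1010,
-- xxz with 0 < x < z for 1120.  Reading from left to right, the number of continuations depends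
-- only on d and on how much of a trigger has been seen.  For 1010, d is 0 until a trigger occurs
-- and at most 1 afterwards, so the counts satisfy a finite linear system.  For 1120, d is
-- unbounded, but linear relations between the counts for d and d + 1 close the system at d = 0.
-- Both systems satisfy the recurrence given by the denominator.

open import Defs
open import Data.Bool.Base using (if_then_else_)
open import Data.Fin.Base as Fin using (Fin; zero; suc; toℕ)
import Data.Fin.Properties as Fin
open import Data.Integer.Base as ℤ using (+_; -_; 0ℤ; 1ℤ)
import Data.Integer.Properties as ℤ
import Data.Integer.Tactic.RingSolver as ℤ-Solver
open import Data.List.Base
  using (List; []; _∷_; [_]; _++_; map; length; lookup; take; drop; reverse; _ʳ++_
        ; concatMap; applyUpTo)
open import Data.List.Membership.Propositional using (_∈_; find; lose)
open import Data.List.Membership.Propositional.Properties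
  using (∈-map⁺; ∈-map⁻; ∈-concatMap⁺; ∈-concatMap⁻; ∈-applyUpTo⁺; ∈-applyUpTo⁻)
open import Data.List.Membership.Propositional.Properties.WithK using (unique∧set⇒bag)
import Data.List.Properties as List
open import Data.List.Relation.Binary.BagAndSetEquality using (∼bag⇒↭)
open import Data.List.Relation.Binary.Disjoint.Propositional using (Disjoint)
open import Data.List.Relation.Binary.Permutation.Propositional.Properties using (↭-length)
open import Data.List.Relation.Binary.Sublist.Propositional as Sublist
  using (_⊆_; []; _∷_; _∷ʳ_; ⊆-refl; ⊆-trans; minimum; from∈)
import Data.List.Relation.Binary.Sublist.Propositional.Properties as Sublist
open import Data.List.Relation.Unary.All as All using (All; []; _∷_)
import Data.List.Relation.Unary.All.Properties as All
open import Data.List.Relation.Unary.AllPairs as AllPairs using ([]; _∷_)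
import Data.List.Relation.Unary.AllPairs.Properties as AllPairs
open import Data.List.Relation.Unary.Any using (here; there)
open import Data.List.Relation.Unary.Unique.Propositional using (Unique)
import Data.List.Relation.Unary.Unique.Propositional.Properties as Unique
open import Data.Nat.Base as ℕ using (ℕ; zero; suc; _+_; _∸_; _≤_; _<_; z≤n; s≤s; z<s; s<s)
open import Data.Nat.ListAction using (sum)
import Data.Nat.Properties as ℕ
import Data.Nat.Tactic.RingSolver as ℕ-Solver
open import Data.Product.Base using (∃-syntax; ∃₂; _×_; _,_; proj₁; proj₂)
open import Data.Sum.Base using (_⊎_; inj₁; inj₂)
open import Data.Vec.Base as Vec using (Vec; []; _∷_)
import Data.Vec.Properties as Vec
open import Function.Base using (_∘_)
open import Function.Bundles using (_⇔_; mk⇔; Equivalence)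
open import Relation.Binary.Definitions using (tri<; tri≈; tri>)
open import Relation.Binary.PropositionalEquality
  using (_≡_; _≢_; refl; sym; trans; cong; cong₂; subst; subst₂; module ≡-Reasoning)
open import Relation.Nullary using (¬_; does; yes; no; contradiction)
open import Relation.Nullary.Decidable using (dec-true; dec-false)

open Equivalence using (to; from)

-- Power series and linear recurrences

-- The slack d is the excess of the number of ascents over the largest letter m. A jump to m + 1 + j
-- adds one ascent and raises the maximum by j + 1, so it spends j of d. A return from a final 0 to
-- m > 0 adds an ascent and keeps the maximum; it is the only letter that raises d. For 1010 such a
-- return completes x0x, after which no 0, and hence no further return, is possible. For 1120
-- returns to a repeated m are harmless, so d can grow without limit. Once closed, each linear
-- system has one eigenvalue too many: its characteristic polynomial (for 1120 after eliminating one
-- sequence) is (t - 1)(t - 2)²(t² - 3t + 1), while the denominator accounts only for the factors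
-- other than t - 1. A linear relation between the counts, true at length 0 and preserved by every
-- step, removes the extra factor. Relations between counts stay in additive form, so that no
-- truncated subtraction enters.

VanishesFrom : ℕ → Series → Set
VanishesFrom a f = ∀ j → f (a + j) ≡ 0ℤ

-- A degree bound: degree below a times degree at most b has degree below a + b. With the asymmetric
-- `suc b` the case a = 0 says f = 0, and the induction peels `f 0` off the convolution.
*-vanishes : ∀ a b f g → VanishesFrom a f → VanishesFrom (suc b) g →
             VanishesFrom (a + b) (f * g)
*-vanishes zero b f g f≈0 g≈0 j = go f f≈0 (b + j)
  where
  go : ∀ f → VanishesFrom 0 f → VanishesFrom 0 (f * g)
  go f f≈0 zero    = cong (λ c → c ℤ.* g 0 ℤ.+ 0ℤ) (f≈0 0)
  go f f≈0 (suc n) = cong₂ (λ c d → c ℤ.* g (suc n) ℤ.+ d) (f≈0 0) (go (f ∘ suc) (f≈0 ∘ suc) n)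
*-vanishes (suc a) b f g f≈0 g≈0 j = cong₂ ℤ._+_ head≡0 (*-vanishes a b (f ∘ suc) g f≈0 g≈0 j)
  where
  open ≡-Reasoning
  head≡0 : f 0 ℤ.* g (suc (a + b + j)) ≡ 0ℤ
  head≡0 = begin
    f 0 ℤ.* g (suc (a + b + j))    ≡⟨ cong (λ i → f 0 ℤ.* g (suc (i + j))) (ℕ.+-comm a b) ⟩
    f 0 ℤ.* g (suc (b + a + j))    ≡⟨ cong (λ i → f 0 ℤ.* g (suc i)) (ℕ.+-assoc b a j) ⟩
    f 0 ℤ.* g (suc (b + (a + j)))  ≡⟨ cong (f 0 ℤ.*_) (g≈0 (a + j)) ⟩
    f 0 ℤ.* 0ℤ                     ≡⟨ ℤ.*-zeroʳ (f 0) ⟩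
    0ℤ                             ∎

numerator-vanishes : VanishesFrom 5 numerator
numerator-vanishes =
  *-vanishes 2 3 (poly (1ℤ ∷ - 1ℤ ∷ [])) (poly (1ℤ ∷ - + 5 ∷ + 7 ∷ - 1ℤ ∷ []))
             (λ _ → refl) (λ _ → refl)

denominator-vanishes : VanishesFrom 5 denominator
denominator-vanishes =
  *-vanishes 3 2 (1-2x * 1-2x) (poly (1ℤ ∷ - + 3 ∷ 1ℤ ∷ []))
             (*-vanishes 2 1 1-2x 1-2x (λ _ → refl) (λ _ → refl)) (λ _ → refl)
  where
  1-2x : Series
  1-2x = poly (1ℤ ∷ - + 2 ∷ [])

-- The case 0 evaluates the coefficients of the expanded denominator. Each further step drops the
-- first term of the convolution, whose factor `denominator (5 + n)` is zero.
*-denominator : ∀ q n → (q * denominator) (4 + n) ≡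
  q n ℤ.* + 4 ℤ.+ (q (1 + n) ℤ.* - + 16 ℤ.+
    (q (2 + n) ℤ.* + 17 ℤ.+ (q (3 + n) ℤ.* - + 7 ℤ.+ (q (4 + n) ℤ.* 1ℤ ℤ.+ 0ℤ))))
*-denominator q zero    = refl
*-denominator q (suc n) = begin
  q 0 ℤ.* denominator (5 + n) ℤ.+ ((q ∘ suc) * denominator) (4 + n)
    ≡⟨ cong (λ c → q 0 ℤ.* c ℤ.+ ((q ∘ suc) * denominator) (4 + n)) (denominator-vanishes n) ⟩
  q 0 ℤ.* 0ℤ ℤ.+ ((q ∘ suc) * denominator) (4 + n)
    ≡⟨ cong (ℤ._+ ((q ∘ suc) * denominator) (4 + n)) (ℤ.*-zeroʳ (q 0)) ⟩
  0ℤ ℤ.+ ((q ∘ suc) * denominator) (4 + n)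
    ≡⟨ ℤ.+-identityˡ _ ⟩
  ((q ∘ suc) * denominator) (4 + n)
    ≡⟨ *-denominator (q ∘ suc) n ⟩
  _ ∎
  where open ≡-Reasoning

-- 1 - 7x + 17x² - 16x³ + 4x⁴ is the expanded denominator; the negative terms are moved
-- to the other side.
Recurrence : (ℕ → ℕ) → Set
Recurrence q = ∀ n →
  q (4 + n) + 17 ℕ.* q (2 + n) + 4 ℕ.* q n ≡ 7 ℕ.* q (3 + n) + 16 ℕ.* q (1 + n)

recurrence-ℤ : ∀ a b c d e → e + 17 ℕ.* c + 4 ℕ.* a ≡ 7 ℕ.* d + 16 ℕ.* b →
  + a ℤ.* + 4 ℤ.+ (+ b ℤ.* - + 16 ℤ.+
    (+ c ℤ.* + 17 ℤ.+ (+ d ℤ.* - + 7 ℤ.+ (+ e ℤ.* 1ℤ ℤ.+ 0ℤ)))) ≡ 0ℤ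
recurrence-ℤ a b c d e eq = begin
  _
    ≡⟨ rearrange (+ a) (+ b) (+ c) (+ d) (+ e) ⟩
  + e ℤ.+ + 17 ℤ.* + c ℤ.+ + 4 ℤ.* + a ℤ.- (+ 7 ℤ.* + d ℤ.+ + 16 ℤ.* + b)
    ≡⟨ cong₂ (λ y z → + e ℤ.+ y ℤ.+ z ℤ.- (+ 7 ℤ.* + d ℤ.+ + 16 ℤ.* + b))
             (ℤ.pos-* 17 c) (ℤ.pos-* 4 a) ⟨
  + (e + 17 ℕ.* c + 4 ℕ.* a) ℤ.- (+ 7 ℤ.* + d ℤ.+ + 16 ℤ.* + b)
    ≡⟨ cong₂ (λ y z → + (e + 17 ℕ.* c + 4 ℕ.* a) ℤ.- (y ℤ.+ z))
             (ℤ.pos-* 7 d) (ℤ.pos-* 16 b) ⟨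
  + (e + 17 ℕ.* c + 4 ℕ.* a) ℤ.- + (7 ℕ.* d + 16 ℕ.* b)
    ≡⟨ cong (λ y → + y ℤ.- + (7 ℕ.* d + 16 ℕ.* b)) eq ⟩
  + (7 ℕ.* d + 16 ℕ.* b) ℤ.- + (7 ℕ.* d + 16 ℕ.* b)
    ≡⟨ ℤ.+-inverseʳ (+ (7 ℕ.* d + 16 ℕ.* b)) ⟩
  0ℤ ∎
  where
  open ≡-Reasoning
  rearrange : ∀ a b c d e →
    a ℤ.* + 4 ℤ.+ (b ℤ.* - + 16 ℤ.+ (c ℤ.* + 17 ℤ.+ (d ℤ.* - + 7 ℤ.+ (e ℤ.* 1ℤ ℤ.+ 0ℤ))))
    ≡ e ℤ.+ + 17 ℤ.* c ℤ.+ + 4 ℤ.* a ℤ.- (+ 7 ℤ.* d ℤ.+ + 16 ℤ.* b)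
  rearrange = ℤ-Solver.solve-∀

-- The numerator has degree 4 like the denominator, so the recurrence can hold only from index 1 on.
-- At index 0 it misses by the numerator's coefficient of x⁴: 14 + 17·2 + 4·1 exceeds 7·5 + 16·1 by
-- 1.
quotient-series : ∀ (q : ℕ → ℕ) → q 0 ≡ 1 → q 1 ≡ 1 → q 2 ≡ 2 → q 3 ≡ 5 → q 4 ≡ 14 →
  Recurrence (q ∘ suc) → (+_ ∘ q) ≈ numerator ÷ denominator [ refl ]
quotient-series q q0 q1 q2 q3 q4 rec = ÷-unique (+_ ∘ q) numerator denominator refl product
  where
  product : (+_ ∘ q) * denominator ≈ numerator
  product 0 rewrite q0 = refl
  product 1 rewrite q0 | q1 = refl
  product 2 rewrite q0 | q1 | q2 = refl
  product 3 rewrite q0 | q1 | q2 | q3 = refl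
  product 4 rewrite q0 | q1 | q2 | q3 | q4 = refl
  product (suc (suc (suc (suc (suc n))))) = begin
    ((+_ ∘ q) * denominator) (5 + n)
      ≡⟨ *-denominator (+_ ∘ q) (suc n) ⟩
    _
      ≡⟨ recurrence-ℤ (q (1 + n)) (q (2 + n)) (q (3 + n)) (q (4 + n)) (q (5 + n)) (rec n) ⟩
    0ℤ
      ≡⟨ numerator-vanishes n ⟨
    numerator (5 + n) ∎
    where open ≡-Reasoning

+-cancel-≡ : ∀ {a b} c d → c ≡ d → a + c ≡ b + d → a ≡ b
+-cancel-≡ {a} {b} c .c refl = ℕ.+-cancelʳ-≡ c a b

-- By `expand`, the difference of the two sides of the recurrence for `i` is identically (l + q) -
-- (i + p). This linear form is an eigenvector of the step for the eigenvalue 1, hence constant, and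
-- `base` makes it zero.
recurrence₁₀₁₀ : ∀ (i h l p q : ℕ → ℕ) →
  i 0 + p 0 ≡ l 0 + q 0 →
  (∀ n → i (suc n) ≡ i n + h n) →
  (∀ n → h (suc n) ≡ l n + 2 ℕ.* h n) →
  (∀ n → l (suc n) ≡ l n + h n + p n) →
  (∀ n → p (suc n) ≡ 2 ℕ.* p n + q n) →
  (∀ n → q (suc n) ≡ 2 ℕ.* q n) →
  Recurrence i
recurrence₁₀₁₀ i h l p q base i′ h′ l′ p′ q′ n
  rewrite i′ (3 + n) | h′ (2 + n)
        | i′ (2 + n) | h′ (1 + n) | l′ (1 + n)
        | i′ (1 + n) | h′ n | l′ n | p′ n
        | i′ n
  = +-cancel-≡ (i n + p n) (l n + q n) (balance n)
      (expand (i n) (h n) (l n) (p n) (q n))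
  where
  step : ∀ i h l p q → i + p ≡ l + q → i + h + (2 ℕ.* p + q) ≡ l + h + p + 2 ℕ.* q
  step i h l p q eq = begin
    i + h + (2 ℕ.* p + q)  ≡⟨ left i h p q ⟩
    i + p + (h + p + q)    ≡⟨ cong (_+ (h + p + q)) eq ⟩
    l + q + (h + p + q)    ≡⟨ right l h p q ⟩
    l + h + p + 2 ℕ.* q    ∎
    where
    open ≡-Reasoning
    left : ∀ i h p q → i + h + (2 ℕ.* p + q) ≡ i + p + (h + p + q)
    left = ℕ-Solver.solve-∀
    right : ∀ l h p q → l + q + (h + p + q) ≡ l + h + p + 2 ℕ.* q
    right = ℕ-Solver.solve-∀
  balance : ∀ n → i n + p n ≡ l n + q n
  balance zero = base
  balance (suc n) rewrite i′ n | p′ n | l′ n | q′ n = step (i n) (h n) (l n) (p n) (q n) (balance n)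
  expand : ∀ i h l p q →
    let h₁ = l + 2 ℕ.* h; l₁ = l + h + p; p₁ = 2 ℕ.* p + q; i₁ = i + h
        h₂ = l₁ + 2 ℕ.* h₁; l₂ = l₁ + h₁ + p₁; i₂ = i₁ + h₁
        h₃ = l₂ + 2 ℕ.* h₂; i₃ = i₂ + h₂; i₄ = i₃ + h₃
    in i₄ + 17 ℕ.* i₂ + 4 ℕ.* i + (i + p) ≡ 7 ℕ.* i₃ + 16 ℕ.* i₁ + (l + q)
  expand = ℕ-Solver.solve-∀

-- Two relations are needed: `balance₁` eliminates `l`, and `balance₂` removes the eigenvalue 1 of
-- the remaining five sequences, as in the case of 1010.
recurrence₁₁₂₀ : ∀ (i s l e f p : ℕ → ℕ) →
  s 0 + f 0 ≡ l 0 + e 0 →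
  i 0 + e 0 ≡ s 0 + p 0 →
  (∀ n → i (suc n) ≡ i n + s n) →
  (∀ n → s (suc n) ≡ l n + e n + s n) →
  (∀ n → l (suc n) + p n ≡ l n + s n + (f n + e n)) →
  (∀ n → e (suc n) ≡ f n + e n + p n) →
  (∀ n → f (suc n) ≡ 2 ℕ.* f n + e n) →
  (∀ n → p (suc n) ≡ 2 ℕ.* p n) →
  Recurrence i
recurrence₁₁₂₀ i s l e f p base₁ base₂ i′ s′ l′ e′ f′ p′ = solution
  where
  open ≡-Reasoning

  balance₁ : ∀ n → s n + f n ≡ l n + e n
  balance₁ zero = base₁
  -- One step turns both sides into `l n + s n + 2 (f n + e n)`. The term `p n` is added to both
  -- because `l′` determines `l (suc n)` only in a sum with it.
  balance₁ (suc n) rewrite s′ n | f′ n | e′ n = ℕ.+-cancelʳ-≡ (p n) _ _ (begin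
    l n + e n + s n + (2 ℕ.* f n + e n) + p n
      ≡⟨ left (l n) (e n) (s n) (f n) (p n) ⟩
    l n + s n + (f n + e n) + (f n + e n + p n)
      ≡⟨ cong (_+ (f n + e n + p n)) (l′ n) ⟨
    l (suc n) + p n + (f n + e n + p n)
      ≡⟨ right (l (suc n)) (p n) (f n + e n + p n) ⟩
    l (suc n) + (f n + e n + p n) + p n ∎)
    where
    left : ∀ l e s f p →
      l + e + s + (2 ℕ.* f + e) + p ≡ l + s + (f + e) + (f + e + p)
    left = ℕ-Solver.solve-∀
    right : ∀ a b c → a + b + c ≡ a + c + b
    right = ℕ-Solver.solve-∀

  s″ : ∀ n → s (suc n) ≡ s n + f n + s n
  s″ n = trans (s′ n) (cong (_+ s n) (sym (balance₁ n)))

  balance₂ : ∀ n → i n + e n ≡ s n + p n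
  balance₂ zero = base₂
  balance₂ (suc n) rewrite i′ n | e′ n | s″ n | p′ n = begin
    i n + s n + (f n + e n + p n)  ≡⟨ left (i n) (s n) (f n) (e n) (p n) ⟩
    i n + e n + (s n + f n + p n)  ≡⟨ cong (_+ (s n + f n + p n)) (balance₂ n) ⟩
    s n + p n + (s n + f n + p n)  ≡⟨ right (s n) (p n) (f n) ⟩
    s n + f n + s n + 2 ℕ.* p n    ∎
    where
    left : ∀ i s f e p → i + s + (f + e + p) ≡ i + e + (s + f + p)
    left = ℕ-Solver.solve-∀
    right : ∀ s p f → s + p + (s + f + p) ≡ s + f + s + 2 ℕ.* p
    right = ℕ-Solver.solve-∀

  expand : ∀ i s e f p →
    let s₁ = s + f + s; f₁ = 2 ℕ.* f + e; e₁ = f + e + p; i₁ = i + s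
        s₂ = s₁ + f₁ + s₁; f₂ = 2 ℕ.* f₁ + e₁; i₂ = i₁ + s₁
        s₃ = s₂ + f₂ + s₂; i₃ = i₂ + s₂; i₄ = i₃ + s₃
    in i₄ + 17 ℕ.* i₂ + 4 ℕ.* i + (i + e) ≡ 7 ℕ.* i₃ + 16 ℕ.* i₁ + (s + p)
  expand = ℕ-Solver.solve-∀

  solution : Recurrence i
  solution n
    rewrite i′ (3 + n) | s″ (2 + n)
          | i′ (2 + n) | s″ (1 + n) | f′ (1 + n)
          | i′ (1 + n) | s″ n | f′ n | e′ n
          | i′ n
    = +-cancel-≡ (i n + e n) (s n + p n) (balance₂ n)
        (expand (i n) (s n) (e n) (f n) (p n))

-- Occurrences of patterns as sublists

-- `drop k π` holds the entries at positions from k on. Choosing position i leaves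
-- `drop (suc (toℕ i)) π` for the later, strictly larger positions.
lookup-∷-drop-⊆ : ∀ (π : List ℕ) (i : Fin (length π)) k → k ≤ toℕ i →
                  lookup π i ∷ drop (suc (toℕ i)) π ⊆ drop k π
lookup-∷-drop-⊆ (x ∷ π) zero    zero    _         = ⊆-refl
lookup-∷-drop-⊆ (x ∷ π) (suc i) zero    _         = x ∷ʳ lookup-∷-drop-⊆ π i zero z≤n
lookup-∷-drop-⊆ (x ∷ π) (suc i) (suc k) (s≤s k≤i) = lookup-∷-drop-⊆ π i k k≤i

Increasing : ∀ {n m} → Vec (Fin n) m → Set
Increasing ι = ∀ j k → j Fin.< k → Vec.lookup ι j Fin.< Vec.lookup ι k

entries-⊆ : ∀ π {m} (ι : Vec (Fin (length π)) m) → Increasing ι →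
            Vec.toList (Vec.map (lookup π) ι) ⊆ π
entries-⊆ π ι incr = go ι incr 0 (λ _ → z≤n)
  where
  go : ∀ {m} (ι : Vec (Fin (length π)) m) → Increasing ι →
       ∀ k → (∀ j → k ≤ toℕ (Vec.lookup ι j)) → Vec.toList (Vec.map (lookup π) ι) ⊆ drop k π
  go []      incr k k≤ι = minimum _
  go (i ∷ ι) incr k k≤ι =
    ⊆-trans (refl ∷ go ι (λ j l j<l → incr (suc j) (suc l) (s≤s j<l)) (suc (toℕ i))
                       (λ j → incr zero (suc j) z<s))
            (lookup-∷-drop-⊆ π i k (k≤ι zero))

module _ {f : ℕ → ℕ} (f-mono : ∀ {i j} → i < j → f i < f j) where

  embed : ∀ {π} τ → map f τ ⊆ π → Fin (length τ) → Fin (length π)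
  embed (t ∷ τ) (_ ∷ʳ p) j       = suc (embed (t ∷ τ) p j)
  embed (_ ∷ τ) (_ ∷ p)  zero    = zero
  embed (_ ∷ τ) (_ ∷ p)  (suc j) = suc (embed τ p j)

  embed-< : ∀ {π} τ (p : map f τ ⊆ π) j k → j Fin.< k → embed τ p j Fin.< embed τ p k
  embed-< (t ∷ τ) (_ ∷ʳ p) j       k       j<k       = s≤s (embed-< (t ∷ τ) p j k j<k)
  embed-< (_ ∷ τ) (_ ∷ p)  zero    (suc k) _         = z<s
  embed-< (_ ∷ τ) (_ ∷ p)  (suc j) (suc k) (s≤s j<k) = s≤s (embed-< τ p j k j<k)

  lookup-embed : ∀ {π} τ (p : map f τ ⊆ π) j → lookup π (embed τ p j) ≡ f (lookup τ j)
  lookup-embed (t ∷ τ) (_ ∷ʳ p)   j       = lookup-embed (t ∷ τ) p j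
  lookup-embed (_ ∷ τ) (refl ∷ p) zero    = refl
  lookup-embed (_ ∷ τ) (_ ∷ p)    (suc j) = lookup-embed τ p j

  mono-<⇔ : ∀ a b → f a < f b ⇔ a < b
  mono-<⇔ a b = mk⇔ reflect f-mono
    where
    reflect : f a < f b → a < b
    reflect fa<fb with ℕ.<-cmp a b
    ... | tri< a<b _ _  = a<b
    ... | tri≈ _ refl _ = contradiction fa<fb (ℕ.<-irrefl refl)
    ... | tri> _ _ b<a  = contradiction fa<fb (ℕ.<-asym (f-mono b<a))

  mono-≡⇔ : ∀ a b → f a ≡ f b ⇔ a ≡ b
  mono-≡⇔ a b = mk⇔ reflect (cong f)
    where
    reflect : f a ≡ f b → a ≡ b
    reflect fa≡fb with ℕ.<-cmp a b
    ... | tri< a<b _ _ = contradiction fa≡fb (ℕ.<⇒≢ (f-mono a<b))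
    ... | tri≈ _ a≡b _ = a≡b
    ... | tri> _ _ b<a = contradiction (sym fa≡fb) (ℕ.<⇒≢ (f-mono b<a))

  -- A strictly increasing relabelling preserves and reflects < and ≡, so exhibiting the relabelled
  -- pattern as a sublist settles every order condition at once.
  map-⊆⇒contains : ∀ π τ → map f τ ⊆ π → π Contains τ
  map-⊆⇒contains π τ p = ι , increasing , order
    where
    ι : Vec (Fin (length π)) (length τ)
    ι = Vec.tabulate (embed τ p)
    increasing : Increasing ι
    increasing j k j<k =
      subst₂ Fin._<_ (sym (Vec.lookup∘tabulate (embed τ p) j))
                     (sym (Vec.lookup∘tabulate (embed τ p) k)) (embed-< τ p j k j<k)
    entry : ∀ j → lookup π (Vec.lookup ι j) ≡ f (lookup τ j)
    entry j = trans (cong (lookup π) (Vec.lookup∘tabulate (embed τ p) j)) (lookup-embed τ p j)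
    order : ∀ j k →
        (lookup π (Vec.lookup ι j) < lookup π (Vec.lookup ι k) ⇔ lookup τ j < lookup τ k)
      × (lookup π (Vec.lookup ι j) ≡ lookup π (Vec.lookup ι k) ⇔ lookup τ j ≡ lookup τ k)
    order j k rewrite entry j | entry k =
      mono-<⇔ (lookup τ j) (lookup τ k) , mono-≡⇔ (lookup τ j) (lookup τ k)

⊆-reverse⇒reverse-⊆ : ∀ {σ : List ℕ} π → σ ⊆ reverse π → reverse σ ⊆ π
⊆-reverse⇒reverse-⊆ π p = subst (_ ⊆_) (List.reverse-involutive π) (Sublist.reverse⁺ p)

-- Ascent sequences and pattern avoidance on reversed words

-- A prefix of a word is kept reversed from here on, so that appending a letter is _∷_.

ascents : List ℕ → ℕ
ascents []          = 0
ascents (_ ∷ [])    = 0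
ascents (y ∷ x ∷ r) = (if does (x ℕ.<? y) then 1 else 0) + ascents (x ∷ r)

ascents-> : ∀ {x y} r → x < y → ascents (y ∷ x ∷ r) ≡ suc (ascents (x ∷ r))
ascents-> {x} {y} r x<y rewrite dec-true (x ℕ.<? y) x<y = refl

ascents-≤ : ∀ {x y} r → y ≤ x → ascents (y ∷ x ∷ r) ≡ ascents (x ∷ r)
ascents-≤ {x} {y} r y≤x rewrite dec-false (x ℕ.<? y) (ℕ.≤⇒≯ y≤x) = refl

-- The accumulator has an explicit head x so that the possible ascent from x to the first letter of
-- w is counted, inside `asc (x ∷ w)`.
ascents-ʳ++ : ∀ w x r → ascents (w ʳ++ (x ∷ r)) ≡ asc (x ∷ w) + ascents (x ∷ r)
ascents-ʳ++ []      x r = refl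
ascents-ʳ++ (y ∷ w) x r = begin
  ascents (w ʳ++ (y ∷ x ∷ r))                ≡⟨ ascents-ʳ++ w y (x ∷ r) ⟩
  asc (y ∷ w) + (bit + ascents (x ∷ r))      ≡⟨ ℕ.+-assoc (asc (y ∷ w)) bit _ ⟨
  asc (y ∷ w) + bit + ascents (x ∷ r)        ≡⟨ cong (_+ ascents (x ∷ r)) (ℕ.+-comm _ bit) ⟩
  bit + asc (y ∷ w) + ascents (x ∷ r)        ∎
  where
  open ≡-Reasoning
  bit : ℕ
  bit = if does (x ℕ.<? y) then 1 else 0

ascents-reverse : ∀ w → ascents (reverse w) ≡ asc w
ascents-reverse []      = refl
ascents-reverse (x ∷ w) = trans (ascents-ʳ++ w x []) (ℕ.+-identityʳ (asc (x ∷ w)))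

-- Two implications, matching the two clauses of `IsAscentSequence` with the position replaced by
-- the length of the prefix.
Allowed : List ℕ → ℕ → Set
Allowed r x = (length r ≡ 0 → x ≡ 0) × (0 < length r → x ≤ ascents r + 1)

data AscentReversed : List ℕ → Set where
  []  : AscentReversed []
  _∷_ : ∀ {x r} → Allowed r x → AscentReversed r → AscentReversed (x ∷ r)

AllowedFrom : List ℕ → List ℕ → Set
AllowedFrom r w = ∀ i → Allowed (take (toℕ i) w ʳ++ r) (lookup w i)

ascent-ʳ++⁺ : ∀ w {r} → AscentReversed r → AllowedFrom r w → AscentReversed (w ʳ++ r)
ascent-ʳ++⁺ []      asc-r ok = asc-r
ascent-ʳ++⁺ (x ∷ w) asc-r ok = ascent-ʳ++⁺ w (ok zero ∷ asc-r) (ok ∘ suc)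

ascent-ʳ++⁻ : ∀ w {r} → AscentReversed (w ʳ++ r) → AscentReversed r × AllowedFrom r w
ascent-ʳ++⁻ []      asc-r = asc-r , λ ()
ascent-ʳ++⁻ (x ∷ w) asc-w with ascent-ʳ++⁻ w asc-w
... | ok ∷ asc-r , oks = asc-r , λ { zero → ok ; (suc i) → oks i }

length-reverse-take : ∀ (w : List ℕ) i → length (reverse (take (toℕ {length w} i) w)) ≡ toℕ i
length-reverse-take w i = begin
  length (reverse (take (toℕ i) w))  ≡⟨ List.length-reverse (take (toℕ i) w) ⟩
  length (take (toℕ i) w)            ≡⟨ List.length-take (toℕ i) w ⟩
  toℕ i ℕ.⊓ length w                 ≡⟨ ℕ.m≤n⇒m⊓n≡m (ℕ.<⇒≤ (Fin.toℕ<n i)) ⟩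
  toℕ i                              ∎
  where open ≡-Reasoning

isAscentSequence⇔ : ∀ w → IsAscentSequence w ⇔ AscentReversed (reverse w)
isAscentSequence⇔ w = mk⇔ forward backward
  where
  forward : IsAscentSequence w → AscentReversed (reverse w)
  forward (first , rest) = ascent-ʳ++⁺ w [] λ i →
    let len = length-reverse-take w i in
    (λ len≡0 → first i (trans (sym len) len≡0)) ,
    (λ 0<len → subst (λ a → lookup w i ≤ a + 1) (sym (ascents-reverse (take (toℕ i) w)))
                     (rest i (subst (0 <_) len 0<len)))
  backward : AscentReversed (reverse w) → IsAscentSequence w
  backward asc-w =
    let ok = proj₂ (ascent-ʳ++⁻ w asc-w) in
    (λ i i≡0 → proj₁ (ok i) (trans (length-reverse-take w i) i≡0)) ,
    (λ i 0<i → subst (λ a → lookup w i ≤ a + 1) (ascents-reverse (take (toℕ i) w))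
                     (proj₂ (ok i) (subst (0 <_) (sym (length-reverse-take w i)) 0<i)))

-- For an ascent sequence, which starts with 0, this is avoidance of 021.
NonzeroIncreasing : List ℕ → Set
NonzeroIncreasing r = ∀ {x y} → y ∷ x ∷ [] ⊆ r → y ≡ 0 ⊎ x ≤ y

-- For words whose nonzero letters increase, avoiding 1010 or 1120 means that no 0 follows
-- a trigger: a subsequence x0x or xxz of the word, respectively.
data Trigger₁₀₁₀ : List ℕ → Set where
  x0x : ∀ {x} → 0 < x → Trigger₁₀₁₀ (x ∷ 0 ∷ x ∷ [])

data Trigger₁₁₂₀ : List ℕ → Set where
  zxx : ∀ {x z} → 0 < x → x < z → Trigger₁₁₂₀ (z ∷ x ∷ x ∷ [])

-- Each condition passes to prefixes, so valid words can be grown one letter at a time.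
record Valid (Trigger : List ℕ → Set) (r : List ℕ) : Set where
  field
    ascent     : AscentReversed r
    increasing : NonzeroIncreasing r
    untouched  : ∀ {σ} → Trigger σ → ¬ 0 ∷ σ ⊆ r

module _ (w : List ℕ) (ascent : IsAscentSequence w) where

  -- The leading 0 completes any later descent x > y > 0 to an occurrence of 021. If x is the
  -- leading 0 itself, then x ≤ y.
  avoids-021⇒increasing : w Avoids p021 → NonzeroIncreasing (reverse w)
  avoids-021⇒increasing avoids {x} {y} p = go w (proj₁ ascent) (⊆-reverse⇒reverse-⊆ w p) avoids
    where
    go : ∀ w → (∀ i → toℕ i ≡ 0 → lookup w i ≡ 0) →
         x ∷ y ∷ [] ⊆ w → w Avoids p021 → y ≡ 0 ⊎ x ≤ y
    go (a ∷ w) first q avoids with first zero refl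
    go (_ ∷ w) first (refl ∷ q) avoids | refl = inj₂ z≤n
    go (_ ∷ w) first (_ ∷ʳ q)   avoids | refl with y ℕ.≟ 0 | x ℕ.≤? y
    ... | yes y≡0 | _       = inj₁ y≡0
    ... | no _    | yes x≤y = inj₂ x≤y
    ... | no y≢0  | no x≰y  =
      contradiction (map-⊆⇒contains mono (0 ∷ w) p021 (refl ∷ q)) avoids
      where
      -- The letters of `p021` need only the values 0, y, x at 0, 1, 2; beyond that `f` continues
      -- with slope 1 to stay strictly increasing.
      f : ℕ → ℕ
      f zero          = 0
      f (suc zero)    = y
      f (suc (suc n)) = n + x
      mono : ∀ {i j} → i < j → f i < f j
      mono {zero}        {suc zero}    _ = ℕ.n≢0⇒n>0 y≢0
      mono {zero}        {suc (suc j)} _ =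
        ℕ.<-≤-trans (ℕ.≤-<-trans z≤n (ℕ.≰⇒> x≰y)) (ℕ.m≤n+m x j)
      mono {suc zero}    {suc (suc j)} _ = ℕ.<-≤-trans (ℕ.≰⇒> x≰y) (ℕ.m≤n+m x j)
      mono {suc (suc i)} {suc (suc j)} (s≤s (s≤s i<j)) = ℕ.+-monoˡ-< x i<j
      mono {suc zero}    {suc zero}    (s≤s ())

increasing⇒avoids-021 : ∀ w → NonzeroIncreasing (reverse w) → w Avoids p021
increasing⇒avoids-021 w increasing (i ∷ j ∷ k ∷ [] , incr , order)
  with increasing (Sublist.reverse⁺ (⊆-trans (_ ∷ʳ ⊆-refl) (entries-⊆ w (i ∷ j ∷ k ∷ []) incr)))
... | inj₁ z≡0 =
  contradiction (subst (lookup w i <_) z≡0 (from (proj₁ (order zero (suc (suc zero)))) z<s)) ℕ.n≮0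
... | inj₂ y≤z =
  contradiction (from (proj₁ (order (suc (suc zero)) (suc zero))) (s<s z<s)) (ℕ.≤⇒≯ y≤z)

-- Only `triggered` assumes increasing nonzero letters: the lowest letter of the occurrence comes
-- after a larger one, and this forces it to be 0.
record Characterises (Trigger : List ℕ → Set) (τ : List ℕ) : Set where
  field
    contains  : ∀ w {σ} → Trigger σ → 0 ∷ σ ⊆ reverse w → w Contains τ
    triggered : ∀ w → NonzeroIncreasing (reverse w) → w Contains τ →
                ∃[ σ ] Trigger σ × 0 ∷ σ ⊆ reverse w

B⇔Valid : ∀ {Trigger τ} → Characterises Trigger τ → ∀ n w →
          B τ n w ⇔ (length w ≡ n × Valid Trigger (reverse w))
B⇔Valid {Trigger} {τ} char n w = mk⇔ forward backward
  where
  open Characterises char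
  forward : B τ n w → length w ≡ n × Valid Trigger (reverse w)
  forward (len , ascent , avoids-021 , avoids-τ) = len , record
    { ascent     = to (isAscentSequence⇔ w) ascent
    ; increasing = avoids-021⇒increasing w ascent avoids-021
    ; untouched  = λ t p → avoids-τ (contains w t p)
    }
  backward : length w ≡ n × Valid Trigger (reverse w) → B τ n w
  backward (len , valid) =
    len , from (isAscentSequence⇔ w) ascent , increasing⇒avoids-021 w increasing ,
    λ c → let _ , t , p = triggered w increasing c in untouched t p
    where open Valid valid

characterises₁₀₁₀ : Characterises Trigger₁₀₁₀ p1010
characterises₁₀₁₀ = record { contains = contains ; triggered = triggered }
  where
  contains : ∀ w {σ} → Trigger₁₀₁₀ σ → 0 ∷ σ ⊆ reverse w → w Contains p1010
  contains w (x0x {suc x} _) p = map-⊆⇒contains mono w p1010 (⊆-reverse⇒reverse-⊆ w p)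
    where
    f : ℕ → ℕ
    f zero    = 0
    f (suc n) = n + suc x
    mono : ∀ {i j} → i < j → f i < f j
    mono {zero}  {suc j} _         = ℕ.<-≤-trans z<s (ℕ.m≤n+m (suc x) j)
    mono {suc i} {suc j} (s≤s i<j) = ℕ.+-monoˡ-< (suc x) i<j
  triggered : ∀ w → NonzeroIncreasing (reverse w) → w Contains p1010 →
              ∃[ σ ] Trigger₁₀₁₀ σ × 0 ∷ σ ⊆ reverse w
  triggered w increasing (ι , incr , order) with ι
  ... | i ∷ j ∷ k ∷ l ∷ [] = go (entries-⊆ w (i ∷ j ∷ k ∷ l ∷ []) incr)
      (from (proj₂ (order zero (suc (suc zero)))) refl)
      (from (proj₂ (order (suc zero) (suc (suc (suc zero))))) refl)
      (from (proj₁ (order (suc zero) zero)) z<s)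
    where
    go : ∀ {a b c d} → a ∷ b ∷ c ∷ d ∷ [] ⊆ w → a ≡ c → b ≡ d → b < a →
         ∃[ σ ] Trigger₁₀₁₀ σ × 0 ∷ σ ⊆ reverse w
    go p refl refl b<a with increasing (Sublist.reverse⁺ (⊆-trans (refl ∷ refl ∷ minimum _) p))
    ... | inj₁ refl = _ , x0x b<a , Sublist.reverse⁺ p
    ... | inj₂ a≤b  = contradiction b<a (ℕ.≤⇒≯ a≤b)

characterises₁₁₂₀ : Characterises Trigger₁₁₂₀ p1120
characterises₁₁₂₀ = record { contains = contains ; triggered = triggered }
  where
  contains : ∀ w {σ} → Trigger₁₁₂₀ σ → 0 ∷ σ ⊆ reverse w → w Contains p1120
  contains w (zxx {suc x} {z} _ x<z) p = map-⊆⇒contains mono w p1120 (⊆-reverse⇒reverse-⊆ w p)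
    where
    f : ℕ → ℕ
    f zero          = 0
    f (suc zero)    = suc x
    f (suc (suc n)) = n + z
    mono : ∀ {i j} → i < j → f i < f j
    mono {zero}        {suc zero}    _ = z<s
    mono {zero}        {suc (suc j)} _ = ℕ.<-≤-trans (ℕ.≤-<-trans z≤n x<z) (ℕ.m≤n+m z j)
    mono {suc zero}    {suc zero}    (s≤s ())
    mono {suc zero}    {suc (suc j)} _ = ℕ.<-≤-trans x<z (ℕ.m≤n+m z j)
    mono {suc (suc i)} {suc (suc j)} (s≤s (s≤s i<j)) = ℕ.+-monoˡ-< z i<j
  triggered : ∀ w → NonzeroIncreasing (reverse w) → w Contains p1120 →
              ∃[ σ ] Trigger₁₁₂₀ σ × 0 ∷ σ ⊆ reverse w
  triggered w increasing (ι , incr , order) with ι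
  ... | i ∷ j ∷ k ∷ l ∷ [] = go (entries-⊆ w (i ∷ j ∷ k ∷ l ∷ []) incr)
      (from (proj₂ (order zero (suc zero))) refl)
      (from (proj₁ (order zero (suc (suc zero)))) (s<s z<s))
      (from (proj₁ (order (suc (suc (suc zero))) zero)) z<s)
    where
    go : ∀ {a b c d} → a ∷ b ∷ c ∷ d ∷ [] ⊆ w → a ≡ b → a < c → d < a →
         ∃[ σ ] Trigger₁₁₂₀ σ × 0 ∷ σ ⊆ reverse w
    go p refl a<c d<a
      with increasing (Sublist.reverse⁺ (⊆-trans (refl ∷ _ ∷ʳ _ ∷ʳ ⊆-refl) p))
    ... | inj₁ refl = _ , zxx d<a a<c , Sublist.reverse⁺ p
    ... | inj₂ a≤d  = contradiction d<a (ℕ.≤⇒≯ a≤d)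

-- Generating words by an automaton

-- The next letter, relative to the largest letter so far.
data Move : Set where
  zero stay : Move
  up        : ℕ → Move

letter : ℕ → Move → ℕ
letter m zero   = 0
letter m stay   = m
letter m (up j) = suc (j + m)

maximum : ℕ → Move → ℕ
maximum m zero   = m
maximum m stay   = m
maximum m (up j) = suc (j + m)

module Enumeration {Kind : Set} (moves : Kind → List (Move × Kind)) where

  run : ℕ → ℕ → Kind → List (List ℕ)
  extend : ℕ → ℕ → Move × Kind → List (List ℕ)
  run zero    m k = [ [] ]
  run (suc n) m k = concatMap (extend n m) (moves k)
  extend n m (a , k) = map (letter m a ∷_) (run n (maximum m a) k)

  -- The maximum m decides which letters are written but not which moves exist, so it disappears
  -- from the count.
  count : ℕ → Kind → ℕ
  count zero    k = 1
  count (suc n) k = sum (map (count n ∘ proj₂) (moves k))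

  length-run : ∀ n m k → length (run n m k) ≡ count n k
  length-run zero    m k = refl
  length-run (suc n) m k = go (moves k)
    where
    open ≡-Reasoning
    go : ∀ ts → length (concatMap (extend n m) ts) ≡ sum (map (count n ∘ proj₂) ts)
    go []             = refl
    go ((a , k) ∷ ts) = begin
      length (extend n m (a , k) ++ concatMap (extend n m) ts)
        ≡⟨ List.length-++ (extend n m (a , k)) ⟩
      length (extend n m (a , k)) + length (concatMap (extend n m) ts)
        ≡⟨ cong₂ _+_ (trans (List.length-map _ (run n (maximum m a) k))
                            (length-run n (maximum m a) k))
                     (go ts) ⟩
      count n k + sum (map (count n ∘ proj₂) ts) ∎

  -- Four obligations about a single letter make `run` list every valid continuation exactly once.
  -- `inv-complete` may look at one letter only because validity passes to prefixes; `inv-distinct`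
  -- excludes repetitions.
  module Correctness {Trigger : List ℕ → Set} (Inv : List ℕ → ℕ → Kind → Set)
    (inv-valid : ∀ {r m k} → Inv r m k → Valid Trigger r)
    (inv-step : ∀ {r m k a k′} → Inv r m k → (a , k′) ∈ moves k →
                Inv (letter m a ∷ r) (maximum m a) k′)
    (inv-complete : ∀ {r m k x} → Inv r m k → Valid Trigger (x ∷ r) →
                    ∃₂ λ a k′ → (a , k′) ∈ moves k × letter m a ≡ x)
    (inv-distinct : ∀ {r m k} → Inv r m k → Unique (map (letter m ∘ proj₁) (moves k)))
    where

    valid-tail : ∀ {x r} → Valid Trigger (x ∷ r) → Valid Trigger r
    valid-tail {x} v with Valid.ascent v
    ... | _ ∷ ascent = record
      { ascent     = ascent
      ; increasing = λ p → Valid.increasing v (x ∷ʳ p)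
      ; untouched  = λ t p → Valid.untouched v t (x ∷ʳ p)
      }

    valid-ʳ++ : ∀ w {r} → Valid Trigger (w ʳ++ r) → Valid Trigger r
    valid-ʳ++ []      v = v
    valid-ʳ++ (x ∷ w) v = valid-tail (valid-ʳ++ w v)

    ∈-run⁻ : ∀ n {r m k w} → Inv r m k → w ∈ run n m k → length w ≡ n × Valid Trigger (w ʳ++ r)
    ∈-run⁻ zero inv (here refl) = refl , inv-valid inv
    ∈-run⁻ (suc n) {m = m} {k} inv w∈
      with (a , k′) , t∈ , w∈′ ← find (∈-concatMap⁻ (extend n m) {xs = moves k} w∈)
      with w′ , w′∈ , refl ← ∈-map⁻ (letter m a ∷_) w∈′
      with len , v ← ∈-run⁻ n (inv-step inv t∈) w′∈ = cong suc len , v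

    ∈-run⁺ : ∀ {r m k} w → Inv r m k → Valid Trigger (w ʳ++ r) → w ∈ run (length w) m k
    ∈-run⁺ []      inv v = here refl
    ∈-run⁺ {m = m} (x ∷ w) inv v
      with a , k′ , t∈ , refl ← inv-complete inv (valid-ʳ++ w v) =
      ∈-concatMap⁺ (extend (length w) m)
        (lose t∈ (∈-map⁺ (letter m a ∷_) (∈-run⁺ w (inv-step inv t∈) v)))

    run-unique : ∀ n {r m k} → Inv r m k → Unique (run n m k)
    run-unique zero inv = [] ∷ []
    run-unique (suc n) {m = m} inv = Unique.concat⁺
      (All.map⁺ (All.tabulate λ t∈ →
        Unique.map⁺ List.∷-injectiveʳ (run-unique n (inv-step inv t∈))))
      (AllPairs.map⁺ (AllPairs.map disjoint (AllPairs.map⁻ (inv-distinct inv))))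
      where
      disjoint : ∀ {s t} → letter m (proj₁ s) ≢ letter m (proj₁ t) →
                 Disjoint (extend n m s) (extend n m t)
      disjoint {a , _} {b , _} a≢b (v∈s , v∈t)
        with _ , _ , refl ← ∈-map⁻ (letter m a ∷_) v∈s
        with _ , _ , eq ← ∈-map⁻ (letter m b ∷_) v∈t = a≢b (List.∷-injectiveˡ eq)

    -- Two duplicate-free lists with the same members are permutations of each other, hence equally
    -- long.
    b≡count : ∀ {τ k} → Characterises Trigger τ → Inv [] 0 k → ∀ n → b τ n ≡ count n k
    b≡count {τ} {k} char inv n = trans
      (↭-length (∼bag⇒↭
        (unique∧set⇒bag (B-list-unique τ n) (run-unique n inv) (mk⇔ forward backward))))
      (length-run n 0 k)
      where
      forward : ∀ {w} → w ∈ B-list τ n → w ∈ run n 0 k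
      forward {w} w∈ with refl , v ← to (B⇔Valid char n w) (to (B-list-correct τ n w) w∈) =
        ∈-run⁺ w inv v
      backward : ∀ {w} → w ∈ run n 0 k → w ∈ B-list τ n
      backward {w} w∈ = from (B-list-correct τ n w) (from (B⇔Valid char n w) (∈-run⁻ n inv w∈))

-- `up j` skips j letters above the maximum and so spends j of the slack d; this permits j = 0, ...,
-- d.
ups : ∀ {Kind : Set} → (ℕ → Kind) → ℕ → List (Move × Kind)
ups c d = applyUpTo (λ j → up j , c (d ∸ j)) (suc d)

∈-ups⁺ : ∀ {Kind : Set} (c : ℕ → Kind) {d} j e → j + e ≡ d → (up j , c e) ∈ ups c d
∈-ups⁺ c j e refl =
  subst (λ i → (up j , c i) ∈ ups c (j + e)) (ℕ.m+n∸m≡n j e)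
        (∈-applyUpTo⁺ (λ i → up i , c (j + e ∸ i)) (s≤s (ℕ.m≤m+n j e)))

∈-ups⁻ : ∀ {Kind : Set} (c : ℕ → Kind) d {a k} → (a , k) ∈ ups c d →
         ∃₂ λ j e → j + e ≡ d × a ≡ up j × k ≡ c e
∈-ups⁻ c d t∈ with j , s≤s j≤d , refl ← ∈-applyUpTo⁻ (λ i → up i , c (d ∸ i)) t∈ =
  j , d ∸ j , ℕ.m+[n∸m]≡n j≤d , refl , refl

ups-distinct : ∀ {Kind : Set} m (c : ℕ → Kind) d → Unique (map (letter m ∘ proj₁) (ups c d))
ups-distinct m c d =
  subst Unique (sym (List.map-applyUpTo (λ j → up j , c (d ∸ j)) (letter m ∘ proj₁) (suc d)))
    (Unique.applyUpTo⁺₁ (λ j → suc (j + m)) (suc d)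
      (λ i<j _ eq → ℕ.<⇒≢ i<j (ℕ.+-cancelʳ-≡ m _ _ (ℕ.suc-injective eq))))

ups-≢ : ∀ {Kind : Set} m (c : ℕ → Kind) d {x} → x ≤ m →
        All (x ≢_) (map (letter m ∘ proj₁) (ups c d))
ups-≢ m c d x≤m =
  All.map⁺ (All.applyUpTo⁺₂ (λ j → up j , c (d ∸ j)) (suc d)
    (λ j → ℕ.<⇒≢ (s≤s (ℕ.≤-trans x≤m (ℕ.m≤n+m m j)))))

-- Prefixes avoiding 021: maximum and slack

record Core (r : List ℕ) (m d : ℕ) : Set where
  field
    ascent     : AscentReversed r
    increasing : NonzeroIncreasing r
    bounded    : ∀ {x} → x ∈ r → x ≤ m
    attained   : m ∈ r
    slack      : ascents r ≡ m + d

⊆⇒∈ : ∀ {x : ℕ} {σ r} → x ∷ σ ⊆ r → x ∈ r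
⊆⇒∈ p = Sublist.lookup p (here refl)

∈⇒nonempty : ∀ {x : ℕ} {r} → x ∈ r → length r ≢ 0
∈⇒nonempty (here _)  ()
∈⇒nonempty (there _) ()

module _ {r m d} (core : Core r m d) where
  open Core core

  allowed : ∀ {x} → x ≤ m + d + 1 → Allowed r x
  allowed x≤ = (λ r≡[] → contradiction r≡[] (∈⇒nonempty attained)) ,
               (λ _ → subst (λ a → _ ≤ a + 1) (sym slack) x≤)

  increasing-∷ : ∀ {x} → x ≡ 0 ⊎ m ≤ x → NonzeroIncreasing (x ∷ r)
  increasing-∷ _            (_ ∷ʳ p)   = increasing p
  increasing-∷ (inj₁ x≡0)   (refl ∷ p) = inj₁ x≡0
  increasing-∷ (inj₂ m≤x)   (refl ∷ p) = inj₂ (ℕ.≤-trans (bounded (⊆⇒∈ p)) m≤x)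

  core-up : ∀ {j e} → j + e ≡ d → Core (suc (j + m) ∷ r) (suc (j + m)) e
  core-up {j} {e} refl = record
    { ascent     = allowed (subst (suc (j + m) ≤_) top (ℕ.m≤m+n (suc (j + m)) e)) ∷ ascent
    ; increasing = increasing-∷ (inj₂ (ℕ.<⇒≤ m<new))
    ; bounded    = λ { (here refl) → ℕ.≤-refl ; (there x∈) → ℕ.≤-trans (bounded x∈) (ℕ.<⇒≤ m<new) }
    ; attained   = here refl
    ; slack      = slack′ attained bounded slack
    }
    where
    m<new : m < suc (j + m)
    m<new = s≤s (ℕ.m≤n+m m j)
    rearrange : ∀ j m e → suc (j + m) + e ≡ m + (j + e) + 1
    rearrange = ℕ-Solver.solve-∀
    top : suc (j + m) + e ≡ m + (j + e) + 1
    top = rearrange j m e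
    slack′ : ∀ {r} → m ∈ r → (∀ {x} → x ∈ r → x ≤ m) → ascents r ≡ m + (j + e) →
             ascents (suc (j + m) ∷ r) ≡ suc (j + m) + e
    slack′ {x ∷ r} _ bounded slack = begin
      ascents (suc (j + m) ∷ x ∷ r)
        ≡⟨ ascents-> r (s≤s (ℕ.≤-trans (bounded (here refl)) (ℕ.m≤n+m m j))) ⟩
      suc (ascents (x ∷ r))          ≡⟨ cong suc slack ⟩
      suc (m + (j + e))              ≡⟨ ℕ.+-comm 1 _ ⟩
      m + (j + e) + 1                ≡⟨ top ⟨
      suc (j + m) + e                ∎
      where open ≡-Reasoning

  core-zero : Core (0 ∷ r) m d
  core-zero = record
    { ascent     = allowed z≤n ∷ ascent
    ; increasing = increasing-∷ (inj₁ refl)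
    ; bounded    = λ { (here refl) → z≤n ; (there x∈) → bounded x∈ }
    ; attained   = there attained
    ; slack      = trans (slack′ attained) slack
    }
    where
    slack′ : ∀ {r} → m ∈ r → ascents (0 ∷ r) ≡ ascents r
    slack′ {x ∷ r} _ = ascents-≤ r z≤n

  -- Comparing x with an earlier occurrence of m leaves x = 0 or m ≤ x. The ascent bound x ≤ m + d +
  -- 1 then limits a jump to j ≤ d.
  core-choices : ∀ {x} → AscentReversed (x ∷ r) → NonzeroIncreasing (x ∷ r) →
                 x ≡ 0 ⊎ m ≡ x ⊎ ∃₂ λ j e → j + e ≡ d × suc (j + m) ≡ x
  core-choices {x} (ok ∷ _) incr with incr (refl ∷ from∈ attained)
  ... | inj₁ x≡0 = inj₁ x≡0
  ... | inj₂ m≤x with ℕ.m≤n⇒m<n∨m≡n m≤x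
  ...   | inj₂ m≡x = inj₂ (inj₁ m≡x)
  ...   | inj₁ m<x = inj₂ (inj₂ (j , d ∸ j , ℕ.m+[n∸m]≡n j≤d , new≡x))
    where
    j : ℕ
    j = x ∸ suc m
    new≡x : suc (j + m) ≡ x
    new≡x = trans (sym (ℕ.+-suc j m)) (ℕ.m∸n+n≡m m<x)
    x≤ : x ≤ suc (d + m)
    x≤ = subst (x ≤_)
               (trans (cong (_+ 1) slack) (trans (ℕ.+-comm (m + d) 1) (cong suc (ℕ.+-comm m d))))
               (proj₂ ok (ℕ.n≢0⇒n>0 (∈⇒nonempty attained)))
    j≤d : j ≤ d
    j≤d = ℕ.+-cancelʳ-≤ m j d (ℕ.≤-pred (subst (_≤ suc (d + m)) (sym new≡x) x≤))


core-stay : ∀ {r m d} → Core (m ∷ r) m d → Core (m ∷ m ∷ r) m d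
core-stay {r} {m} {d} core = record
  { ascent     = allowed core (ℕ.≤-trans (ℕ.m≤m+n m d) (ℕ.m≤m+n (m + d) 1)) ∷ ascent
  ; increasing = increasing-∷ core (inj₂ ℕ.≤-refl)
  ; bounded    = λ { (here refl) → ℕ.≤-refl ; (there x∈) → bounded x∈ }
  ; attained   = here refl
  ; slack      = trans (ascents-≤ r ℕ.≤-refl) slack
  }
  where open Core core

-- Going from 0 back to m is an ascent without a new maximum, so the slack grows by one.
core-return : ∀ {r m d} → 0 < m → Core (0 ∷ r) m d → Core (m ∷ 0 ∷ r) m (suc d)
core-return {r} {m} {d} 0<m core = record
  { ascent     = allowed core (ℕ.≤-trans (ℕ.m≤m+n m d) (ℕ.m≤m+n (m + d) 1)) ∷ ascent
  ; increasing = increasing-∷ core (inj₂ ℕ.≤-refl)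
  ; bounded    = λ { (here refl) → ℕ.≤-refl ; (there x∈) → bounded x∈ }
  ; attained   = here refl
  ; slack      = trans (ascents-> r 0<m) (trans (cong suc slack) (sym (ℕ.+-suc m d)))
  }
  where open Core core

core-start : Core (0 ∷ []) 0 0
core-start = record
  { ascent     = ((λ _ → refl) , λ ()) ∷ []
  ; increasing = λ { (_ ∷ʳ ()) ; (_ ∷ ()) }
  ; bounded    = λ { (here refl) → z≤n }
  ; attained   = here refl
  ; slack      = refl
  }

-- Prefixes without a trigger and prefixes sealed by one

module _ (Trigger : List ℕ → Set) where

  Free : List ℕ → Set
  Free r = ∀ {σ} → Trigger σ → ¬ σ ⊆ r

  Untouched : List ℕ → Set
  Untouched r = ∀ {σ} → Trigger σ → ¬ 0 ∷ σ ⊆ r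

  -- The stored trigger rules out every further 0, so from here on the word weakly increases and its
  -- slack never grows again.
  record Sealed (r : List ℕ) (m d : ℕ) : Set where
    field
      positive  : 0 < m
      core      : Core r m d
      untouched : Untouched r
      trigger   : ∃[ σ ] Trigger σ × σ ⊆ r

module _ {Trigger : List ℕ → Set} where

  free⇒untouched : ∀ {r} → Free Trigger r → Untouched Trigger r
  free⇒untouched free t p = free t (⊆-trans (0 ∷ʳ ⊆-refl) p)

  untouched-∷ : ∀ {x r} → 0 < x → Untouched Trigger r → Untouched Trigger (x ∷ r)
  untouched-∷ _   untouched t (_ ∷ʳ p)   = untouched t p
  untouched-∷ 0<x untouched t (refl ∷ p) = contradiction 0<x ℕ.n≮0

  valid : ∀ {r m d} → Core r m d → Untouched Trigger r → Valid Trigger r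
  valid core untouched = record
    { ascent = Core.ascent core ; increasing = Core.increasing core ; untouched = untouched }

  sealed-valid : ∀ {r m d} → Sealed Trigger r m d → Valid Trigger r
  sealed-valid s = valid (Sealed.core s) (Sealed.untouched s)

  seal : ∀ {x r d σ} → 0 < x → Core (x ∷ r) x d → Free Trigger r → Trigger σ → σ ⊆ x ∷ r →
         Sealed Trigger (x ∷ r) x d
  seal 0<x core free t p = record
    { positive  = 0<x
    ; core      = core
    ; untouched = untouched-∷ 0<x (free⇒untouched free)
    ; trigger   = _ , t , p
    }

  sealed-∷ : ∀ {x r m d e} → 0 < x → Core (x ∷ r) x e → Sealed Trigger r m d →
             Sealed Trigger (x ∷ r) x e
  sealed-∷ {x} 0<x core s = record
    { positive  = 0<x
    ; core      = core
    ; untouched = untouched-∷ 0<x (Sealed.untouched s)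
    ; trigger   = let σ , t , p = Sealed.trigger s in σ , t , x ∷ʳ p
    }

  sealed-choices : ∀ {x r m d} → Sealed Trigger r m d → Valid Trigger (x ∷ r) →
                   m ≡ x ⊎ ∃₂ λ j e → j + e ≡ d × suc (j + m) ≡ x
  sealed-choices s v with core-choices (Sealed.core s) (Valid.ascent v) (Valid.increasing v)
  ... | inj₁ refl = let _ , t , p = Sealed.trigger s in
                    contradiction (refl ∷ p) (Valid.untouched v t)
  ... | inj₂ c    = c

start-zero : ∀ {x} → AscentReversed (x ∷ []) → 0 ≡ x
start-zero (ok ∷ []) = sym (proj₁ ok refl)

distinct-three : ∀ {m} → 0 < m → Unique (0 ∷ m ∷ suc m ∷ [])
distinct-three 0<m =
  (ℕ.<⇒≢ 0<m ∷ (λ ()) ∷ []) ∷ (ℕ.<⇒≢ (ℕ.n<1+n _) ∷ []) ∷ [] ∷ []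

distinct-ups : ∀ {Kind : Set} {m} (c : ℕ → Kind) d → 0 < m →
               Unique (0 ∷ m ∷ map (letter m ∘ proj₁) (ups c d))
distinct-ups {m = m} c d 0<m =
  (ℕ.<⇒≢ 0<m ∷ ups-≢ m c d z≤n) ∷ ups-≢ m c d ℕ.≤-refl ∷ ups-distinct m c d

-- The pattern 1010

-- `high` and `low` are the trigger-free prefixes with positive maximum m, ending in m and in 0.
-- Their slack is 0, because the return that would raise it leads from `low` to `sealed 1`.
data Kind₁₀₁₀ : Set where
  start zeros high low : Kind₁₀₁₀
  sealed               : ℕ → Kind₁₀₁₀

moves₁₀₁₀ : Kind₁₀₁₀ → List (Move × Kind₁₀₁₀)
moves₁₀₁₀ start      = (zero , zeros) ∷ []
moves₁₀₁₀ zeros      = (zero , zeros) ∷ (up 0 , high) ∷ []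
moves₁₀₁₀ high       = (zero , low) ∷ (stay , high) ∷ (up 0 , high) ∷ []
moves₁₀₁₀ low        = (zero , low) ∷ (stay , sealed 1) ∷ (up 0 , high) ∷ []
moves₁₀₁₀ (sealed d) = (stay , sealed d) ∷ ups sealed d

module Automaton₁₀₁₀ where

  Free₁₀₁₀ : List ℕ → Set
  Free₁₀₁₀ = Free Trigger₁₀₁₀

  data Inv : List ℕ → ℕ → Kind₁₀₁₀ → Set where
    start  : Inv [] 0 start
    zeros  : ∀ {r} → Core r 0 0 → Free₁₀₁₀ r → Inv r 0 zeros
    high   : ∀ {r m} → 0 < m → Core (m ∷ r) m 0 → Free₁₀₁₀ (m ∷ r) → Inv (m ∷ r) m high
    low    : ∀ {r m} → 0 < m → Core (0 ∷ r) m 0 → Free₁₀₁₀ (0 ∷ r) → Inv (0 ∷ r) m low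
    sealed : ∀ {r m d} → Sealed Trigger₁₀₁₀ (m ∷ r) m d → Inv (m ∷ r) m (sealed d)

  free-zero : ∀ {r} → Free₁₀₁₀ r → Free₁₀₁₀ (0 ∷ r)
  free-zero free t         (_ ∷ʳ p)   = free t p
  free-zero free (x0x 0<x) (refl ∷ p) = contradiction 0<x ℕ.n≮0

  -- A trigger that ends in the new m could end in the old one instead, since its middle 0 lies
  -- before both.
  free-stay : ∀ {r m} → Free₁₀₁₀ (m ∷ r) → Free₁₀₁₀ (m ∷ m ∷ r)
  free-stay free t         (_ ∷ʳ p)             = free t p
  free-stay free (x0x 0<x) (refl ∷ (_ ∷ʳ p))    = free (x0x 0<x) (refl ∷ p)
  free-stay free (x0x 0<x) (refl ∷ (refl ∷ p))  = contradiction 0<x ℕ.n≮0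

  free-up : ∀ {r m d} j → Core r m d → Free₁₀₁₀ r → Free₁₀₁₀ (suc (j + m) ∷ r)
  free-up j core free t       (_ ∷ʳ p)   = free t p
  free-up {m = m} j core free (x0x _) (refl ∷ p) =
    ℕ.<⇒≱ (s≤s (ℕ.m≤n+m m j)) (Core.bounded core (⊆⇒∈ (⊆-trans (0 ∷ʳ ⊆-refl) p)))

  inv-valid : ∀ {r m k} → Inv r m k → Valid Trigger₁₀₁₀ r
  inv-valid start             = record
    { ascent = [] ; increasing = λ () ; untouched = λ _ () }
  inv-valid (zeros core free)  = valid core (free⇒untouched free)
  inv-valid (high _ core free) = valid core (free⇒untouched free)
  inv-valid (low _ core free)  = valid core (free⇒untouched free)
  inv-valid (sealed s)         = sealed-valid s

  inv-step : ∀ {r m k a k′} → Inv r m k → (a , k′) ∈ moves₁₀₁₀ k →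
             Inv (letter m a ∷ r) (maximum m a) k′
  inv-step start (here refl) = zeros core-start λ { (x0x _) (_ ∷ʳ ()) ; (x0x _) (_ ∷ ()) }
  inv-step (zeros core free) (here refl) = zeros (core-zero core) (free-zero free)
  inv-step (zeros core free) (there (here refl)) =
    high z<s (core-up core refl) (free-up 0 core free)
  inv-step (high 0<m core free) (here refl) = low 0<m (core-zero core) (free-zero free)
  inv-step (high 0<m core free) (there (here refl)) = high 0<m (core-stay core) (free-stay free)
  inv-step (high 0<m core free) (there (there (here refl))) =
    high z<s (core-up core refl) (free-up 0 core free)
  inv-step (low 0<m core free) (here refl) = low 0<m (core-zero core) (free-zero free)
  inv-step (low 0<m core free) (there (here refl)) =
    -- The final 0 of the prefix, preceded by some m, is the middle of the new x0x.
    sealed (seal 0<m (core-return 0<m core) free (x0x 0<m) (refl ∷ twice 0<m (Core.attained core)))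
    where
    twice : ∀ {m r} → 0 < m → m ∈ 0 ∷ r → 0 ∷ m ∷ [] ⊆ 0 ∷ r
    twice 0<m (here refl) = contradiction 0<m ℕ.n≮0
    twice 0<m (there m∈)  = refl ∷ from∈ m∈
  inv-step (low 0<m core free) (there (there (here refl))) =
    high z<s (core-up core refl) (free-up 0 core free)
  inv-step (sealed s) (here refl) =
    sealed (sealed-∷ (Sealed.positive s) (core-stay (Sealed.core s)) s)
  inv-step (sealed {d = d} s) (there t∈) with _ , _ , eq , refl , refl ← ∈-ups⁻ sealed d t∈ =
    sealed (sealed-∷ z<s (core-up (Sealed.core s) eq) s)

  inv-complete : ∀ {r m k x} → Inv r m k → Valid Trigger₁₀₁₀ (x ∷ r) →
                 ∃₂ λ a k′ → (a , k′) ∈ moves₁₀₁₀ k × letter m a ≡ x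
  inv-complete start v = zero , zeros , here refl , start-zero (Valid.ascent v)
  inv-complete (zeros core _) v with core-choices core (Valid.ascent v) (Valid.increasing v)
  ... | inj₁ refl                               = _ , _ , here refl , refl
  -- With maximum 0, repeating the maximum means writing 0, so both cases are the move `zero`.
  ... | inj₂ (inj₁ refl)                        = _ , _ , here refl , refl
  ... | inj₂ (inj₂ (zero , zero , refl , refl)) = _ , _ , there (here refl) , refl
  inv-complete (high _ core _) v with core-choices core (Valid.ascent v) (Valid.increasing v)
  ... | inj₁ refl                               = _ , _ , here refl , refl
  ... | inj₂ (inj₁ refl)                        = _ , _ , there (here refl) , refl
  ... | inj₂ (inj₂ (zero , zero , refl , refl)) = _ , _ , there (there (here refl)) , refl
  inv-complete (low _ core _) v with core-choices core (Valid.ascent v) (Valid.increasing v)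
  ... | inj₁ refl                               = _ , _ , here refl , refl
  ... | inj₂ (inj₁ refl)                        = _ , _ , there (here refl) , refl
  ... | inj₂ (inj₂ (zero , zero , refl , refl)) = _ , _ , there (there (here refl)) , refl
  inv-complete (sealed s) v with sealed-choices s v
  ... | inj₁ refl                 = _ , _ , here refl , refl
  ... | inj₂ (j , e , eq , refl)  = _ , _ , there (∈-ups⁺ sealed j e eq) , refl

  inv-distinct : ∀ {r m k} → Inv r m k → Unique (map (letter m ∘ proj₁) (moves₁₀₁₀ k))
  inv-distinct start                          = [] ∷ []
  inv-distinct (zeros _ _)                    = ((λ ()) ∷ []) ∷ [] ∷ []
  inv-distinct (high 0<m _ _)                 = distinct-three 0<m
  inv-distinct (low 0<m _ _)                  = distinct-three 0<m
  inv-distinct (sealed {m = m} {d = d} _)     = ups-≢ m sealed d ℕ.≤-refl ∷ ups-distinct m sealed d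

  open Enumeration moves₁₀₁₀
  open Correctness Inv inv-valid inv-step inv-complete inv-distinct

  recurrence : Recurrence (λ n → count (suc n) start)
  recurrence = recurrence₁₀₁₀ (λ n → count (suc n) start) (λ n → count n high) (λ n → count n low)
    (λ n → count n (sealed 1)) (λ n → count n (sealed 0)) refl
    (λ n → start′ (count n zeros) (count n high))
    (λ _ → refl)
    (λ n → low′ (count n low) (count n high) (count n (sealed 1)))
    (λ n → sealed′ (count n (sealed 1)) (count n (sealed 0)))
    (λ _ → refl)
    where
    start′ : ∀ i h → i + (h + 0) + 0 ≡ i + 0 + h
    start′ = ℕ-Solver.solve-∀
    low′ : ∀ l h p → l + (p + (h + 0)) ≡ l + h + p
    low′ = ℕ-Solver.solve-∀
    sealed′ : ∀ p q → p + (p + (q + 0)) ≡ 2 ℕ.* p + q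
    sealed′ = ℕ-Solver.solve-∀

  genFun-1010 : genFun p1010 ≈ numerator ÷ denominator [ refl ]
  genFun-1010 n = trans (cong +_ (b≡count characterises₁₀₁₀ start n))
    (quotient-series (λ n → count n start) refl refl refl refl refl recurrence n)

-- The pattern 1120

-- In `single` and `singleLow` no positive letter has occurred twice; in `double` and `doubleLow`
-- only the maximum has. The suffix `Low` marks a final 0 below a positive maximum.
data Kind₁₁₂₀ : Set where
  start zeros single singleLow : Kind₁₁₂₀
  double doubleLow sealed      : ℕ → Kind₁₁₂₀

moves₁₁₂₀ : Kind₁₁₂₀ → List (Move × Kind₁₁₂₀)
moves₁₁₂₀ start         = (zero , zeros) ∷ []
moves₁₁₂₀ zeros         = (zero , zeros) ∷ (up 0 , single) ∷ []
moves₁₁₂₀ single        = (zero , singleLow) ∷ (stay , double 0) ∷ (up 0 , single) ∷ []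
moves₁₁₂₀ singleLow     = (zero , singleLow) ∷ (stay , double 1) ∷ (up 0 , single) ∷ []
moves₁₁₂₀ (double d)    = (zero , doubleLow d) ∷ (stay , double d) ∷ ups sealed d
moves₁₁₂₀ (doubleLow d) = (zero , doubleLow d) ∷ (stay , double (suc d)) ∷ ups sealed d
moves₁₁₂₀ (sealed d)    = (stay , sealed d) ∷ ups sealed d

module Automaton₁₁₂₀ where

  Unrepeated : List ℕ → Set
  Unrepeated r = ∀ {x} → 0 < x → ¬ x ∷ x ∷ [] ⊆ r

  OnlyRepeated : ℕ → List ℕ → Set
  OnlyRepeated m r = ∀ {x} → 0 < x → x ∷ x ∷ [] ⊆ r → x ≡ m

  data Inv : List ℕ → ℕ → Kind₁₁₂₀ → Set where
    start     : Inv [] 0 start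
    zeros     : ∀ {r} → Core r 0 0 → Unrepeated r → Inv r 0 zeros
    single    : ∀ {r m} → 0 < m → Core (m ∷ r) m 0 → Unrepeated (m ∷ r) → Inv (m ∷ r) m single
    singleLow : ∀ {r m} → 0 < m → Core (0 ∷ r) m 0 → Unrepeated (0 ∷ r) → Inv (0 ∷ r) m singleLow
    double    : ∀ {r m d} → 0 < m → Core (m ∷ r) m d → m ∷ m ∷ [] ⊆ m ∷ r → OnlyRepeated m (m ∷ r) →
                Inv (m ∷ r) m (double d)
    doubleLow : ∀ {r m d} → 0 < m → Core (0 ∷ r) m d → m ∷ m ∷ [] ⊆ 0 ∷ r → OnlyRepeated m (0 ∷ r) →
                Inv (0 ∷ r) m (doubleLow d)
    sealed    : ∀ {r m d} → Sealed Trigger₁₁₂₀ (m ∷ r) m d → Inv (m ∷ r) m (sealed d)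

  unrepeated-zero : ∀ {r} → Unrepeated r → Unrepeated (0 ∷ r)
  unrepeated-zero unrepeated 0<x (_ ∷ʳ p)   = unrepeated 0<x p
  unrepeated-zero unrepeated 0<x (refl ∷ p) = contradiction 0<x ℕ.n≮0

  unrepeated-up : ∀ {r m d} j → Core r m d → Unrepeated r → Unrepeated (suc (j + m) ∷ r)
  unrepeated-up j core unrepeated 0<x (_ ∷ʳ p)   = unrepeated 0<x p
  unrepeated-up {m = m} j core unrepeated 0<x (refl ∷ p) =
    ℕ.<⇒≱ (s≤s (ℕ.m≤n+m m j)) (Core.bounded core (⊆⇒∈ p))

  unrepeated⇒onlyRepeated : ∀ {r m} → Unrepeated r → OnlyRepeated m (m ∷ r)
  unrepeated⇒onlyRepeated unrepeated 0<x (_ ∷ʳ p)   = contradiction p (unrepeated 0<x)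
  unrepeated⇒onlyRepeated unrepeated 0<x (refl ∷ p) = refl

  onlyRepeated-zero : ∀ {r m} → OnlyRepeated m r → OnlyRepeated m (0 ∷ r)
  onlyRepeated-zero only 0<x (_ ∷ʳ p)   = only 0<x p
  onlyRepeated-zero only 0<x (refl ∷ p) = contradiction 0<x ℕ.n≮0

  onlyRepeated-stay : ∀ {r m} → OnlyRepeated m r → OnlyRepeated m (m ∷ r)
  onlyRepeated-stay only 0<x (_ ∷ʳ p)   = only 0<x p
  onlyRepeated-stay only 0<x (refl ∷ p) = refl

  unrepeated⇒free : ∀ {r} → Unrepeated r → Free Trigger₁₁₂₀ r
  unrepeated⇒free unrepeated (zxx 0<x _) p = unrepeated 0<x (⊆-trans (_ ∷ʳ ⊆-refl) p)

  -- The repeated letter of a trigger would be the maximum m, and then nothing can exceed it.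
  onlyRepeated⇒free : ∀ {r m d} → Core r m d → OnlyRepeated m r → Free Trigger₁₁₂₀ r
  onlyRepeated⇒free core only (zxx 0<x x<z) p with only 0<x (⊆-trans (_ ∷ʳ ⊆-refl) p)
  ... | refl = ℕ.<⇒≱ x<z (Core.bounded core (⊆⇒∈ p))

  inv-valid : ∀ {r m k} → Inv r m k → Valid Trigger₁₁₂₀ r
  inv-valid start                   = record
    { ascent = [] ; increasing = λ () ; untouched = λ _ () }
  inv-valid (zeros core unrep)       = valid core (free⇒untouched (unrepeated⇒free unrep))
  inv-valid (single _ core unrep)    = valid core (free⇒untouched (unrepeated⇒free unrep))
  inv-valid (singleLow _ core unrep) = valid core (free⇒untouched (unrepeated⇒free unrep))
  inv-valid (double _ core _ only)    = valid core (free⇒untouched (onlyRepeated⇒free core only))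
  inv-valid (doubleLow _ core _ only) = valid core (free⇒untouched (onlyRepeated⇒free core only))
  inv-valid (sealed s)               = sealed-valid s

  -- Once m has occurred twice, every larger letter completes xxz.
  seal-up : ∀ {r m d e} j → 0 < m → Core r m d → m ∷ m ∷ [] ⊆ r → OnlyRepeated m r → j + e ≡ d →
            Inv (suc (j + m) ∷ r) (suc (j + m)) (sealed e)
  seal-up {m = m} j 0<m core mm only eq = sealed
    (seal z<s (core-up core eq) (onlyRepeated⇒free core only)
          (zxx 0<m (s≤s (ℕ.m≤n+m m j))) (refl ∷ mm))

  inv-step : ∀ {r m k a k′} → Inv r m k → (a , k′) ∈ moves₁₁₂₀ k →
             Inv (letter m a ∷ r) (maximum m a) k′
  inv-step start (here refl) = zeros core-start λ { _ (_ ∷ʳ ()) ; _ (_ ∷ ()) }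
  inv-step (zeros core unrep) (here refl) = zeros (core-zero core) (unrepeated-zero unrep)
  inv-step (zeros core unrep) (there (here refl)) =
    single z<s (core-up core refl) (unrepeated-up 0 core unrep)
  inv-step (single 0<m core unrep) (here refl) =
    singleLow 0<m (core-zero core) (unrepeated-zero unrep)
  inv-step (single 0<m core unrep) (there (here refl)) =
    double 0<m (core-stay core) (refl ∷ from∈ (Core.attained core)) (unrepeated⇒onlyRepeated unrep)
  inv-step (single 0<m core unrep) (there (there (here refl))) =
    single z<s (core-up core refl) (unrepeated-up 0 core unrep)
  inv-step (singleLow 0<m core unrep) (here refl) =
    singleLow 0<m (core-zero core) (unrepeated-zero unrep)
  inv-step (singleLow 0<m core unrep) (there (here refl)) =
    double 0<m (core-return 0<m core) (refl ∷ from∈ (Core.attained core))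
           (unrepeated⇒onlyRepeated unrep)
  inv-step (singleLow 0<m core unrep) (there (there (here refl))) =
    single z<s (core-up core refl) (unrepeated-up 0 core unrep)
  inv-step (double 0<m core mm only) (here refl) =
    doubleLow 0<m (core-zero core) (0 ∷ʳ mm) (onlyRepeated-zero only)
  inv-step (double 0<m core mm only) (there (here refl)) =
    double 0<m (core-stay core) (_ ∷ʳ mm) (onlyRepeated-stay only)
  inv-step (double {d = d} 0<m core mm only) (there (there t∈))
    with j , _ , eq , refl , refl ← ∈-ups⁻ sealed d t∈ = seal-up j 0<m core mm only eq
  inv-step (doubleLow 0<m core mm only) (here refl) =
    doubleLow 0<m (core-zero core) (0 ∷ʳ mm) (onlyRepeated-zero only)
  inv-step (doubleLow 0<m core mm only) (there (here refl)) =
    double 0<m (core-return 0<m core) (_ ∷ʳ mm) (onlyRepeated-stay only)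
  inv-step (doubleLow {d = d} 0<m core mm only) (there (there t∈))
    with j , _ , eq , refl , refl ← ∈-ups⁻ sealed d t∈ = seal-up j 0<m core mm only eq
  inv-step (sealed s) (here refl) =
    sealed (sealed-∷ (Sealed.positive s) (core-stay (Sealed.core s)) s)
  inv-step (sealed {d = d} s) (there t∈) with _ , _ , eq , refl , refl ← ∈-ups⁻ sealed d t∈ =
    sealed (sealed-∷ z<s (core-up (Sealed.core s) eq) s)

  inv-complete : ∀ {r m k x} → Inv r m k → Valid Trigger₁₁₂₀ (x ∷ r) →
                 ∃₂ λ a k′ → (a , k′) ∈ moves₁₁₂₀ k × letter m a ≡ x
  inv-complete start v = zero , zeros , here refl , start-zero (Valid.ascent v)
  inv-complete (zeros core _) v with core-choices core (Valid.ascent v) (Valid.increasing v)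
  ... | inj₁ refl                               = _ , _ , here refl , refl
  ... | inj₂ (inj₁ refl)                        = _ , _ , here refl , refl
  ... | inj₂ (inj₂ (zero , zero , refl , refl)) = _ , _ , there (here refl) , refl
  inv-complete (single _ core _) v with core-choices core (Valid.ascent v) (Valid.increasing v)
  ... | inj₁ refl                               = _ , _ , here refl , refl
  ... | inj₂ (inj₁ refl)                        = _ , _ , there (here refl) , refl
  ... | inj₂ (inj₂ (zero , zero , refl , refl)) = _ , _ , there (there (here refl)) , refl
  inv-complete (singleLow _ core _) v with core-choices core (Valid.ascent v) (Valid.increasing v)
  ... | inj₁ refl                               = _ , _ , here refl , refl
  ... | inj₂ (inj₁ refl)                        = _ , _ , there (here refl) , refl
  ... | inj₂ (inj₂ (zero , zero , refl , refl)) = _ , _ , there (there (here refl)) , refl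
  inv-complete (double _ core _ _) v with core-choices core (Valid.ascent v) (Valid.increasing v)
  ... | inj₁ refl                       = _ , _ , here refl , refl
  ... | inj₂ (inj₁ refl)                = _ , _ , there (here refl) , refl
  ... | inj₂ (inj₂ (j , e , eq , refl)) = _ , _ , there (there (∈-ups⁺ sealed j e eq)) , refl
  inv-complete (doubleLow _ core _ _) v with core-choices core (Valid.ascent v) (Valid.increasing v)
  ... | inj₁ refl                       = _ , _ , here refl , refl
  ... | inj₂ (inj₁ refl)                = _ , _ , there (here refl) , refl
  ... | inj₂ (inj₂ (j , e , eq , refl)) = _ , _ , there (there (∈-ups⁺ sealed j e eq)) , refl
  inv-complete (sealed s) v with sealed-choices s v
  ... | inj₁ refl                = _ , _ , here refl , refl
  ... | inj₂ (j , e , eq , refl) = _ , _ , there (∈-ups⁺ sealed j e eq) , refl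

  inv-distinct : ∀ {r m k} → Inv r m k → Unique (map (letter m ∘ proj₁) (moves₁₁₂₀ k))
  inv-distinct start                           = [] ∷ []
  inv-distinct (zeros _ _)                     = ((λ ()) ∷ []) ∷ [] ∷ []
  inv-distinct (single 0<m _ _)                = distinct-three 0<m
  inv-distinct (singleLow 0<m _ _)             = distinct-three 0<m
  inv-distinct (double {d = d} 0<m _ _ _)      = distinct-ups sealed d 0<m
  inv-distinct (doubleLow {d = d} 0<m _ _ _)   = distinct-ups sealed d 0<m
  inv-distinct (sealed {m = m} {d = d} _)      = ups-≢ m sealed d ℕ.≤-refl ∷ ups-distinct m sealed d

  open Enumeration moves₁₁₂₀
  open Correctness Inv inv-valid inv-step inv-complete inv-distinct

  sealedCount doubleCount lowCount upsCount : ℕ → ℕ → ℕ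
  sealedCount n d = count n (sealed d)
  doubleCount n d = count n (double d)
  lowCount n d    = count n (doubleLow d)
  upsCount n d    = sum (map (count n ∘ proj₂) (ups sealed d))

  -- The move `up (suc j)` at slack d + 1 leaves the same slack as `up j` at slack d, so only the
  -- term of `up 0` is new.
  upsCount-suc : ∀ n d → upsCount n (suc d) ≡ sealedCount n (suc d) + upsCount n d
  upsCount-suc n d = cong (λ ks → sealedCount n (suc d) + sum ks) (begin
    map (count n ∘ proj₂) (applyUpTo (λ j → up (suc j) , sealed (d ∸ j)) (suc d))
      ≡⟨ List.map-applyUpTo (λ j → up (suc j) , sealed (d ∸ j)) (count n ∘ proj₂) (suc d) ⟩
    applyUpTo (λ j → sealedCount n (d ∸ j)) (suc d)
      ≡⟨ List.map-applyUpTo (λ j → up j , sealed (d ∸ j)) (count n ∘ proj₂) (suc d) ⟨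
    map (count n ∘ proj₂) (ups sealed d) ∎)
    where open ≡-Reasoning

  -- The generating functions of `sealed d`, `double d` and `doubleLow d` are all multiplied by
  -- (1 - x)/(1 - 2x) when d increases; the two balances are what makes this induction on the
  -- length work.
  balance : ∀ n →
    (∀ d → lowCount n (suc d) + sealedCount n (suc d) ≡ lowCount n d + doubleCount n (suc d)) ×
    (∀ d → doubleCount n (suc d) + sealedCount n d ≡ lowCount n d + doubleCount n d)
  balance zero = (λ _ → refl) , (λ _ → refl)
  balance (suc n) = first , second
    where
    L D S p : ℕ → ℕ
    L = lowCount n
    D = doubleCount n
    S = upsCount n
    p = sealedCount n
    open ≡-Reasoning
    -- This needs the first relation at d and the second at d + 1 for length n, so both are carried
    -- together and for all d.
    first : ∀ d → L (1 + d) + (D (2 + d) + S (1 + d)) + (p (1 + d) + S (1 + d)) ≡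
                  L d + (D (1 + d) + S d) + (L (1 + d) + (D (1 + d) + S (1 + d)))
    first d rewrite upsCount-suc n d = begin
      L (1 + d) + (D (2 + d) + (p (1 + d) + S d)) + (p (1 + d) + (p (1 + d) + S d))
        ≡⟨ left (L (1 + d)) (D (2 + d)) (p (1 + d)) (S d) ⟩
      L (1 + d) + p (1 + d) + (D (2 + d) + p (1 + d)) + (p (1 + d) + S d + S d)
        ≡⟨ cong₂ (λ y z → y + z + (p (1 + d) + S d + S d))
                 (proj₁ (balance n) d) (proj₂ (balance n) (1 + d)) ⟩
      L d + D (1 + d) + (L (1 + d) + D (1 + d)) + (p (1 + d) + S d + S d)
        ≡⟨ right (L d) (D (1 + d)) (L (1 + d)) (p (1 + d)) (S d) ⟩
      L d + (D (1 + d) + S d) + (L (1 + d) + (D (1 + d) + (p (1 + d) + S d))) ∎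
      where
      left : ∀ l d p s → l + (d + (p + s)) + (p + (p + s)) ≡ l + p + (d + p) + (p + s + s)
      left = ℕ-Solver.solve-∀
      right : ∀ l₀ d l₁ p s → l₀ + d + (l₁ + d) + (p + s + s) ≡ l₀ + (d + s) + (l₁ + (d + (p + s)))
      right = ℕ-Solver.solve-∀
    second : ∀ d → L (1 + d) + (D (1 + d) + S (1 + d)) + (p d + S d) ≡
                   L d + (D (1 + d) + S d) + (L d + (D d + S d))
    second d rewrite upsCount-suc n d = begin
      L (1 + d) + (D (1 + d) + (p (1 + d) + S d)) + (p d + S d)
        ≡⟨ left (L (1 + d)) (D (1 + d)) (p (1 + d)) (p d) (S d) ⟩
      L (1 + d) + p (1 + d) + (D (1 + d) + p d) + (S d + S d)
        ≡⟨ cong₂ (λ y z → y + z + (S d + S d)) (proj₁ (balance n) d) (proj₂ (balance n) d) ⟩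
      L d + D (1 + d) + (L d + D d) + (S d + S d)
        ≡⟨ right (L d) (D (1 + d)) (D d) (S d) ⟩
      L d + (D (1 + d) + S d) + (L d + (D d + S d)) ∎
      where
      left : ∀ l d p₁ p₀ s → l + (d + (p₁ + s)) + (p₀ + s) ≡ l + p₁ + (d + p₀) + (s + s)
      left = ℕ-Solver.solve-∀
      right : ∀ l d₁ d₀ s → l + d₁ + (l + d₀) + (s + s) ≡ l + (d₁ + s) + (l + (d₀ + s))
      right = ℕ-Solver.solve-∀

  recurrence : Recurrence (λ n → count (suc n) start)
  recurrence = recurrence₁₁₂₀ (λ n → count (suc n) start) (λ n → count n single)
    (λ n → count n singleLow) (λ n → doubleCount n 0) (λ n → lowCount n 0) (λ n → sealedCount n 0)
    refl refl
    (λ n → start′ (count n zeros) (count n single))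
    (λ n → single′ (count n singleLow) (doubleCount n 0) (count n single))
    -- `double 1` is the only count with positive slack that enters. The second balance at d = 0
    -- expresses its sum with `sealed 0` by counts of slack 0; the equation for `doubleLow 0` uses
    -- the same relation.
    (λ n → singleLow′ (count n singleLow) (count n single) (doubleCount n 1) (sealedCount n 0)
                     (proj₂ (balance n) 0))
    (λ n → double′ (lowCount n 0) (doubleCount n 0) (sealedCount n 0))
    (λ n → doubleLow′ (lowCount n 0) (doubleCount n 1) (sealedCount n 0) (proj₂ (balance n) 0))
    (λ _ → refl)
    where
    open ≡-Reasoning
    start′ : ∀ i s → i + (s + 0) + 0 ≡ i + 0 + s
    start′ = ℕ-Solver.solve-∀
    single′ : ∀ l e s → l + (e + (s + 0)) ≡ l + e + s
    single′ = ℕ-Solver.solve-∀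
    singleLow′ : ∀ l s d p {x} → d + p ≡ x → l + (d + (s + 0)) + p ≡ l + s + x
    singleLow′ l s d p refl = rearrange l s d p
      where
      rearrange : ∀ l s d p → l + (d + (s + 0)) + p ≡ l + s + (d + p)
      rearrange = ℕ-Solver.solve-∀
    double′ : ∀ f e p → f + (e + (p + 0)) ≡ f + e + p
    double′ = ℕ-Solver.solve-∀
    doubleLow′ : ∀ f d p {e} → d + p ≡ f + e → f + (d + (p + 0)) ≡ 2 ℕ.* f + e
    doubleLow′ f d p {e} eq = begin
      f + (d + (p + 0))  ≡⟨ cong (λ p → f + (d + p)) (ℕ.+-identityʳ p) ⟩
      f + (d + p)        ≡⟨ cong (λ a → f + a) eq ⟩
      f + (f + e)        ≡⟨ rearrange f e ⟩
      2 ℕ.* f + e        ∎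
      where
      rearrange : ∀ f e → f + (f + e) ≡ 2 ℕ.* f + e
      rearrange = ℕ-Solver.solve-∀

  genFun-1120 : genFun p1120 ≈ numerator ÷ denominator [ refl ]
  genFun-1120 n = trans (cong +_ (b≡count characterises₁₁₂₀ start n))
    (quotient-series (λ n → count n start) refl refl refl refl refl recurrence n)

theorem2p8 : (τ : List ℕ) → τ ≡ p1010 ⊎ τ ≡ p1120 →
    genFun τ ≈ numerator ÷ denominator [ refl ]
theorem2p8 _ (inj₁ refl) = Automaton₁₀₁₀.genFun-1010
theorem2p8 _ (inj₂ refl) = Automaton₁₁₂₀.genFun-1120
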